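{- The problem $k$-VERTEX CLIQUE PARTITION restricted to unit 2-interval graphs is W[1]-hard with parameter $k$.
   Context: $k$-VERTEX CLIQUE PARTITION: given a graph $H=(V,E)$ and an integer $k$, decide whether $V$ can be partitioned into $k$ disjoint subsets $V_1,\dots,V_k$ such that each $V_i$ induces a complete subgraph of $H$. The intersection graph of a family of sets has one vertex per member, two different members being adjacent iff they intersect; the family is a representation of the graph. A 2-interval is the union of two disjoint intervals in the real line. A unit 2-interval graph is the intersection graph of a family of 2-intervals in which all intervals have unit length. Such a representation of $H$ is given as part of the input. A parameterized problem is W[1]-hard if every problem in W[1] has an FPT reduction to it; equivalently, if $k$-CLIQUE in general graphs (parameter $k$) has an FPT reduction to it. An FPT reduction maps an instance $(x,k)$ to an equivalent instance $(x',k')$ in time $g(k)\cdot|x|^{O(1)}$ with $k'\le h(k)$, for computable functions $g,h$. -}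

module Defs where

open import Data.Bool using (Bool; true; false; T)
open import Data.Fin using (Fin)
open import Data.Fin.Subset using (Subset; _∈_; _∩_; ∣_∣; Empty)
open import Data.Integer using (ℤ; +_; -[1+_])
open import Data.List using (List; []; _∷_; tabulate)
open import Data.Nat using (ℕ; zero; suc; _+_; _*_; _^_; _≤_; _≡ᵇ_)
open import Data.Nat.Binary using (ℕᵇ; 2[1+_]; 1+[2_])
open import Data.Product using (Σ-syntax; ∃-syntax; _×_; _,_)
open import Data.Sum using (_⊎_)
open import Function.Bundles using (_⇔_)
open import Relation.Binary.PropositionalEquality using (_≡_; _≢_)
open import Relation.Nullary using (¬_)

import Data.Bool as Bool
import Data.Nat.Binary as Binary
import Data.Rational.Unnormalised as ℚᵘ
open ℚᵘ using (ℚᵘ)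

-- Model of computation: Jones's WHILE language (N. D. Jones,
-- "Computability and Complexity", 1997), whose data are binary trees.

infixr 5 _∙_

data Tree : Set where
  nil : Tree
  _∙_ : Tree → Tree → Tree

size : Tree → ℕ
size nil     = 1
size (s ∙ t) = suc (size s + size t)

head tail : Tree → Tree
head nil     = nil
head (s ∙ t) = s
tail nil     = nil
tail (s ∙ t) = t

Var : Set
Var = ℕ

data Exp : Set where
  var   : Var → Exp
  nil   : Exp
  cons  : Exp → Exp → Exp
  hd tl : Exp → Exp

infix  6 _≔_
infixr 5 _⨾_

data Cmd : Set where
  _≔_           : Var → Exp → Cmd
  _⨾_           : Cmd → Cmd → Cmd
  if_then_else_ : Exp → Cmd → Cmd → Cmd
  while_loop_     : Exp → Cmd → Cmd

Store : Set
Store = Var → Tree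

_[_↦_] : Store → Var → Tree → Store
(σ [ x ↦ t ]) y = Bool.if x ≡ᵇ y then t else σ y

eval : Exp → Store → Tree
eval (var x)      σ = σ x
eval nil          σ = nil
eval (cons e₁ e₂) σ = eval e₁ σ ∙ eval e₂ σ
eval (hd e)       σ = head (eval e σ)
eval (tl e)       σ = tail (eval e σ)

-- ⟨ c , σ ⟩⇓⟨ τ , t ⟩ : started in σ, the command c halts in τ after time t.
-- A test counts as true when its value is not nil.
--
-- An assignment costs the size of the value it stores.  With Jones's unit
-- cost, repeating  X ≔ cons X X  would build a tree of exponential size in
-- linear time, which is no reasonable cost for computing a function.  With
-- the cost below, the total size of the store grows by at most the time
-- spent, so times agree with Turing machine times up to a polynomial.
infix 4 ⟨_,_⟩⇓⟨_,_⟩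

data ⟨_,_⟩⇓⟨_,_⟩ : Cmd → Store → Store → ℕ → Set where
  assign      : ∀ {x e σ} →
                ⟨ x ≔ e , σ ⟩⇓⟨ σ [ x ↦ eval e σ ] , size (eval e σ) ⟩
  seq         : ∀ {c d σ τ υ s t} →
                ⟨ c , σ ⟩⇓⟨ τ , s ⟩ → ⟨ d , τ ⟩⇓⟨ υ , t ⟩ →
                ⟨ c ⨾ d , σ ⟩⇓⟨ υ , s + t ⟩
  if-true     : ∀ {e c d σ τ t} → eval e σ ≢ nil →
                ⟨ c , σ ⟩⇓⟨ τ , t ⟩ →
                ⟨ if e then c else d , σ ⟩⇓⟨ τ , suc t ⟩
  if-false    : ∀ {e c d σ τ t} → eval e σ ≡ nil →
                ⟨ d , σ ⟩⇓⟨ τ , t ⟩ →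
                ⟨ if e then c else d , σ ⟩⇓⟨ τ , suc t ⟩
  while-true  : ∀ {e c σ τ υ s t} → eval e σ ≢ nil →
                ⟨ c , σ ⟩⇓⟨ τ , s ⟩ → ⟨ while e loop c , τ ⟩⇓⟨ υ , t ⟩ →
                ⟨ while e loop c , σ ⟩⇓⟨ υ , suc (s + t) ⟩
  while-false : ∀ {e c σ} → eval e σ ≡ nil →
                ⟨ while e loop c , σ ⟩⇓⟨ σ , 1 ⟩

-- Variable 0 holds the input before the run and the output after it.
initial : Tree → Store
initial t = (λ _ → nil) [ 0 ↦ t ]

_maps_to_within_ : Cmd → Tree → Tree → ℕ → Set
p maps s to r within b =
  ∃[ τ ] ∃[ t ] (⟨ p , initial s ⟩⇓⟨ τ , t ⟩ × τ 0 ≡ r × t ≤ b)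

encodeBool : Bool → Tree
encodeBool false = nil
encodeBool true  = nil ∙ nil

encodeUnary : ℕ → Tree
encodeUnary zero    = nil
encodeUnary (suc n) = nil ∙ encodeUnary n

encodeList : ∀ {A : Set} → (A → Tree) → List A → Tree
encodeList f []       = nil
encodeList f (x ∷ xs) = f x ∙ encodeList f xs

-- Bijective base 2, least significant digit first.
encodeℕᵇ : ℕᵇ → Tree
encodeℕᵇ Binary.zero = nil
encodeℕᵇ 2[1+ n ]    = encodeBool true ∙ encodeℕᵇ n
encodeℕᵇ 1+[2 n ]    = encodeBool false ∙ encodeℕᵇ n

encodeBinary : ℕ → Tree
encodeBinary n = encodeℕᵇ (Binary.fromℕ n)

encodeℤ : ℤ → Tree
encodeℤ (+ n)    = encodeBool false ∙ encodeBinary n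
encodeℤ -[1+ n ] = encodeBool true ∙ encodeBinary (suc n)

encodeℚᵘ : ℚᵘ → Tree
encodeℚᵘ q = encodeℤ (ℚᵘ.numerator q) ∙ encodeBinary (ℚᵘ.denominatorℕ q)

record ParameterizedProblem : Set₁ where
  field
    Instance  : Set
    encode    : Instance → Tree
    parameter : Instance → ℕ
    Yes       : Instance → Set

Computable : (ℕ → ℕ) → Set
Computable f =
  ∃[ p ] ∀ n → ∃[ b ] p maps encodeUnary n to encodeUnary (f n) within b

record _≤ᶠᵖᵗ_ (P Q : ParameterizedProblem) : Set where
  private
    module P = ParameterizedProblem P
    module Q = ParameterizedProblem Q
  field
    reduce          : P.Instance → Q.Instance
    equivalent      : ∀ x → P.Yes x ⇔ Q.Yes (reduce x)

    h               : ℕ → ℕ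
    h-computable    : Computable h
    parameter-bound : ∀ x → Q.parameter (reduce x) ≤ h (P.parameter x)

    g               : ℕ → ℕ
    g-computable    : Computable g
    exponent        : ℕ
    program         : Cmd
    program-correct : ∀ x →
      program maps P.encode x to Q.encode (reduce x)
        within (g (P.parameter x) * size (P.encode x) ^ exponent)

record Graph (n : ℕ) : Set where
  field
    adjacent    : Fin n → Fin n → Bool
    symmetric   : ∀ u v → adjacent u v ≡ adjacent v u
    irreflexive : ∀ v → adjacent v v ≡ false

  Adjacent : Fin n → Fin n → Set
  Adjacent u v = T (adjacent u v)

open Graph public using (Adjacent)

encodeGraph : ∀ {n} → Graph n → Tree
encodeGraph G =
  encodeList (encodeList encodeBool)
    (tabulate λ u → tabulate λ v → Graph.adjacent G u v)

IsClique : ∀ {n} → Graph n → Subset n → Set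
IsClique G S = ∀ {u v} → u ∈ S → v ∈ S → u ≢ v → Adjacent G u v

HasClique : ∀ {n} → Graph n → ℕ → Set
HasClique {n} G k = Σ[ S ∈ Subset n ] (∣ S ∣ ≡ k × IsClique G S)

-- The parts may be empty.
record CliquePartition {n} (H : Graph n) (k : ℕ) : Set where
  field
    part     : Fin k → Subset n
    disjoint : ∀ {i j} → i ≢ j → Empty (part i ∩ part j)
    cover    : ∀ v → ∃[ i ] v ∈ part i
    complete : ∀ i → IsClique H (part i)

-- Endpoints are rational because representations are part of the input.
-- Closed intervals with rational endpoints share a real point iff they share
-- a rational one, so rational points suffice to define intersection.

record Interval : Set where
  field
    left right : ℚᵘ
    ordered    : left ℚᵘ.≤ right

  HasUnitLength : Set
  HasUnitLength = right ℚᵘ.- left ℚᵘ.≃ ℚᵘ.1ℚᵘ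

open Interval public using (HasUnitLength)

infix 4 _∈ᴵ_ _∈²_

_∈ᴵ_ : ℚᵘ → Interval → Set
x ∈ᴵ I = Interval.left I ℚᵘ.≤ x × x ℚᵘ.≤ Interval.right I

record TwoInterval : Set where
  field
    first second : Interval
    disjoint     : ¬ (∃[ x ] (x ∈ᴵ first × x ∈ᴵ second))

_∈²_ : ℚᵘ → TwoInterval → Set
x ∈² I = x ∈ᴵ TwoInterval.first I ⊎ x ∈ᴵ TwoInterval.second I

Intersect : TwoInterval → TwoInterval → Set
Intersect I J = ∃[ x ] (x ∈² I × x ∈² J)

record UnitTwoIntervalRepresentation {n} (H : Graph n) : Set where
  field
    interval   : Fin n → TwoInterval
    unit       : ∀ v → HasUnitLength (TwoInterval.first (interval v))
                     × HasUnitLength (TwoInterval.second (interval v))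
    represents : ∀ {u v} → u ≢ v →
                 Adjacent H u v ⇔ Intersect (interval u) (interval v)

encodeInterval : Interval → Tree
encodeInterval I = encodeℚᵘ (Interval.left I) ∙ encodeℚᵘ (Interval.right I)

encodeTwoInterval : TwoInterval → Tree
encodeTwoInterval I =
  encodeInterval (TwoInterval.first I) ∙ encodeInterval (TwoInterval.second I)

encodeRepresentation : ∀ {n} {H : Graph n} →
                       UnitTwoIntervalRepresentation H → Tree
encodeRepresentation R =
  encodeList encodeTwoInterval
    (tabulate (UnitTwoIntervalRepresentation.interval R))

-- Writing k in unary rather than in binary changes instance
-- sizes only by a function of the parameter.

record CliqueInstance : Set where
  field
    {n}   : ℕ
    graph : Graph n
    k     : ℕ

k-Clique : ParameterizedProblem
k-Clique = record
  { Instance  = CliqueInstance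
  ; encode    = λ x → encodeGraph (graph x) ∙ encodeUnary (k x)
  ; parameter = k
  ; Yes       = λ x → HasClique (graph x) (k x)
  }
  where open CliqueInstance

record UnitTwoIntervalInstance : Set where
  field
    {n}            : ℕ
    graph          : Graph n
    representation : UnitTwoIntervalRepresentation graph
    k              : ℕ

k-VertexCliquePartition-unit2Interval : ParameterizedProblem
k-VertexCliquePartition-unit2Interval = record
  { Instance  = UnitTwoIntervalInstance
  ; encode    = λ x → encodeGraph (graph x)
                    ∙ encodeRepresentation (representation x)
                    ∙ encodeUnary (k x)
  ; parameter = k
  ; Yes       = λ x → CliquePartition (graph x) (k x)
  }
  where open UnitTwoIntervalInstance

W[1]-hard : ParameterizedProblem → Set
W[1]-hard Q = k-Clique ≤ᶠᵖᵗ Q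

{-# OPTIONS --safe #-}
module Submission where

-- Write n for the number of vertices of G and k for the clique size, and call
-- two integers near if they differ by at most n - 1, as the starts of two
-- meeting intervals do.  Each i < k gets a region of the line with a ladder of
-- 2-intervals, whose rung s, for 0 ≤ s ≤ n, starts at s and s + 2n + 1.  Rungs 0
-- and n are not adjacent, so the 2k end rungs need 2k different parts, and
-- every rung shares its part with an end rung of its own region.  Hence in
-- each region there is a t < n such that rung t lies with rung 0 and rung t + 1
-- with rung n: the region chooses the vertex t.  For every two regions and
-- every non-adjacent pair (u , v) there is a gate, which starts at u + n + 1 in
-- the one region and at v + n + 1 in the other.  There it meets all rungs but
-- u and u + 1, respectively v and v + 1, so that it fits in no part if u
-- and v are chosen; hence the chosen vertices form a clique.  Conversely, if
-- the vertices of a clique are chosen, then piercing the region of x in x + n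
-- and x + 2n + 1 pierces all 2-intervals, which yields 2k parts.
--
-- The reduction is written in a small functional language whose programs are
-- polynomially bounded by construction, and which is compiled to WHILE.

open import Data.Bool using (Bool; true; false; _∧_; _∨_; T)
open import Data.Bool.Properties using (T-∧; T-∨)
open import Data.Empty using (⊥-elim)
open import Data.Fin using
  (Fin; zero; suc; #_; toℕ; opposite; fromℕ; fromℕ<; inject₁; combine; remQuot; punchOut)
open import Data.Fin.Properties using
  (toℕ-injective; toℕ<n; toℕ-fromℕ; toℕ-fromℕ<; toℕ-inject₁; opposite-suc; opposite-involutive;
   combine-remQuot; remQuot-combine; punchOut-injective; injective⇒≤; any?)
  renaming (_≟_ to _≟ᶠ_; suc-injective to sucᶠ-injective)
open import Data.Fin.Subset as Subset using (Subset; inside; outside; ∣_∣)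
open import Data.Fin.Subset.Properties using (∣⊥∣≡0; ∉⊥; x∈p∩q⁻)
open import Data.Integer as ℤ using () renaming (+_ to pos)
open import Data.List using
  (List; []; _∷_; [_]; _++_; map; concatMap; downFrom; length; tabulate; lookup)
open import Data.List.Membership.Propositional using (_∈_; find; lose)
open import Data.List.Membership.Propositional.Properties using
  (∈-lookup; ∈-concatMap⁺; ∈-concatMap⁻; ∈-downFrom⁺; ∈-downFrom⁻; ∈-++⁺ˡ; ∈-++⁺ʳ; ∈-++⁻)
open import Data.List.Properties using (length-tabulate; tabulate-cong; tabulate-lookup)
open import Data.List.Relation.Unary.Any as Any using (Any; here; there)
open import Data.List.Relation.Unary.Any.Properties using (lookup-index; tabulate⁺; tabulate⁻)
open import Data.Nat
open import Data.Nat.Binary using (2[1+_]; 1+[2_])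
open import Data.Nat.Binary.Properties using (fromℕ≡fromℕ')
open import Data.Nat.Properties
open import Data.Nat.Solver using (module +-*-Solver)
open import Data.Product using (Σ-syntax; ∃-syntax; _×_; _,_; proj₁; proj₂)
open import Data.Rational.Unnormalised as ℚᵘ using (ℚᵘ; mkℚᵘ; *≤*; *≡*)
open import Data.Sum using (_⊎_; inj₁; inj₂; [_,_]′)
open import Data.Vec as Vec using (Vec; []; _∷_; here; there)
open import Data.Vec.Properties using (lookup-map; lookup∘tabulate; lookup⇒[]=; []=⇒lookup)
open import Data.Vec.Relation.Unary.All as All using (All; []; _∷_)
open import Function using (_∘_; Injective)
open import Function.Bundles using (_⇔_; mk⇔; Equivalence)
open import Relation.Binary.Definitions using (Tri; tri<; tri≈; tri>)
open import Relation.Binary.PropositionalEquality hiding ([_])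
open import Relation.Nullary using (¬_; contradiction; yes; no; does)
open import Relation.Nullary.Decidable using (dec-true)

import Data.Bool as Bool
import Data.Integer.Properties as ℤₚ
import Data.Integer.Tactic.RingSolver as ℤSolver
import Data.Nat.Binary as Binary
import Data.Rational.Unnormalised.Properties as ℚᵘₚ

open import Defs

open +-*-Solver using (solve; con; _:=_; _:+_; _:*_)

-- Polynomial bounds

infixl 6 _⊕_
infixl 7 _⊗_
infixr 8 _⊚_

data Poly : Set where
  con         : ℕ → Poly
  X           : Poly
  _⊕_ _⊗_ _⊚_ : Poly → Poly → Poly

evalᵖ : Poly → ℕ → ℕ
evalᵖ (con c) n = c
evalᵖ X       n = n
evalᵖ (p ⊕ q) n = evalᵖ p n + evalᵖ q n
evalᵖ (p ⊗ q) n = evalᵖ p n * evalᵖ q n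
evalᵖ (p ⊚ q) n = evalᵖ p (evalᵖ q n)

evalᵖ-mono : ∀ p {m n} → m ≤ n → evalᵖ p m ≤ evalᵖ p n
evalᵖ-mono (con c) m≤n = ≤-refl
evalᵖ-mono X       m≤n = m≤n
evalᵖ-mono (p ⊕ q) m≤n = +-mono-≤ (evalᵖ-mono p m≤n) (evalᵖ-mono q m≤n)
evalᵖ-mono (p ⊗ q) m≤n = *-mono-≤ (evalᵖ-mono p m≤n) (evalᵖ-mono q m≤n)
evalᵖ-mono (p ⊚ q) m≤n = evalᵖ-mono p (evalᵖ-mono q m≤n)

n<2^n : ∀ n → n < 2 ^ n
n<2^n zero    = s≤s z≤n
n<2^n (suc n) = begin-strict
  suc n           ≤⟨ n<2^n n ⟩
  2 ^ n           <⟨ m<m+n (2 ^ n) (≤-trans (s≤s z≤n) (n<2^n n)) ⟩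
  2 ^ n + 2 ^ n   ≡⟨ cong (2 ^ n +_) (+-identityʳ (2 ^ n)) ⟨
  2 * 2 ^ n       ∎
  where open ≤-Reasoning

-- One power of `n` is to dominate the polynomial once `n` is at least 2: a constant `c` is below
-- `2 ^ c`, and a sum costs one extra factor `n`, which absorbs the doubling.
degree : Poly → ℕ
degree (con c) = c
degree X       = 1
degree (p ⊕ q) = suc (degree p + degree q)
degree (p ⊗ q) = degree p + degree q
degree (p ⊚ q) = suc (degree q) * degree p

evalᵖ≤^ : ∀ p {n} → 2 ≤ n → evalᵖ p n ≤ n ^ degree p
evalᵖ≤^ (con c) {n} 2≤n = ≤-trans (<⇒≤ (n<2^n c)) (^-monoˡ-≤ c 2≤n)
evalᵖ≤^ X       {n} 2≤n = ≤-reflexive (sym (*-identityʳ n))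
evalᵖ≤^ (p ⊕ q) {n@(suc _)} 2≤n = begin
  evalᵖ p n + evalᵖ q n           ≤⟨ +-mono-≤ (evalᵖ≤^ p 2≤n) (evalᵖ≤^ q 2≤n) ⟩
  n ^ a + n ^ b                   ≤⟨ +-mono-≤ (^-monoʳ-≤ n (m≤m+n a b)) (^-monoʳ-≤ n (m≤n+m b a)) ⟩
  n ^ (a + b) + n ^ (a + b)       ≡⟨ cong (n ^ (a + b) +_) (+-identityʳ _) ⟨
  2 * n ^ (a + b)                 ≤⟨ *-monoˡ-≤ (n ^ (a + b)) 2≤n ⟩
  n * n ^ (a + b)                 ∎
  where open ≤-Reasoning
        a = degree p
        b = degree q
evalᵖ≤^ (p ⊗ q) {n} 2≤n = begin
  evalᵖ p n * evalᵖ q n           ≤⟨ *-mono-≤ (evalᵖ≤^ p 2≤n) (evalᵖ≤^ q 2≤n) ⟩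
  n ^ degree p * n ^ degree q     ≡⟨ ^-distribˡ-+-* n (degree p) (degree q) ⟨
  n ^ (degree p + degree q)       ∎
  where open ≤-Reasoning
evalᵖ≤^ (p ⊚ q) {n@(suc _)} 2≤n = begin
  -- The extra factor `n` keeps the argument of `p` at least 2 even if `degree q` is 0.
  evalᵖ p (evalᵖ q n)             ≤⟨ evalᵖ-mono p (≤-trans (evalᵖ≤^ q 2≤n) (m≤n*m (n ^ degree q) n)) ⟩
  evalᵖ p (n ^ suc (degree q))    ≤⟨ evalᵖ≤^ p (≤-trans 2≤n (m≤m*n n (n ^ degree q) {{m^n≢0 n (degree q)}})) ⟩
  (n ^ suc (degree q)) ^ degree p ≡⟨ ^-*-assoc n (suc (degree q)) (degree p) ⟩
  n ^ (suc (degree q) * degree p) ∎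
  where open ≤-Reasoning

-- A polynomially bounded language

-- The right spine of a tree is read as a list.  The body sees the whole
-- remaining list, so that its length is available as a loop counter.
foldTree : (Tree → Tree → Tree) → Tree → Tree → Tree
foldTree f a nil      = a
foldTree f a (t ∙ ts) = foldTree f (f (t ∙ ts) a) ts

-- The accumulator of a fold may grow only by a constant multiple of the value
-- of the body, which keeps all denotations polynomially bounded.
data Term : ℕ → Set
⟦_⟧ : ∀ {n} → Term n → Vec Tree n → Tree

data Term where
  var    : ∀ {n} → Fin n → Term n
  nil    : ∀ {n} → Term n
  _∙_    : ∀ {n} → Term n → Term n → Term n
  hd tl  : ∀ {n} → Term n → Term n
  ifte   : ∀ {n} → Term n → Term n → Term n → Term n
  let-in : ∀ {n} → Term n → Term (suc n) → Term n
  fold   : ∀ {n} → Term n → Term n → Term (suc n) →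
           (comb : Term 2) (c : ℕ) →
           (∀ v a → size (⟦ comb ⟧ (v ∷ a ∷ [])) ≤ size a + c * size v) →
           Term n

branch : Tree → Tree → Tree → Tree
branch nil     t e = e
branch (_ ∙ _) t e = t

⟦ var i ⟧            ρ = Vec.lookup ρ i
⟦ nil ⟧              ρ = nil
⟦ t ∙ u ⟧            ρ = ⟦ t ⟧ ρ ∙ ⟦ u ⟧ ρ
⟦ hd t ⟧             ρ = head (⟦ t ⟧ ρ)
⟦ tl t ⟧             ρ = tail (⟦ t ⟧ ρ)
⟦ ifte t u v ⟧       ρ = branch (⟦ t ⟧ ρ) (⟦ u ⟧ ρ) (⟦ v ⟧ ρ)
⟦ let-in t u ⟧       ρ = ⟦ u ⟧ (⟦ t ⟧ ρ ∷ ρ)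
⟦ fold l z s m _ _ ⟧ ρ =
  foldTree (λ x a → ⟦ m ⟧ (⟦ s ⟧ (x ∷ ρ) ∷ a ∷ [])) (⟦ z ⟧ ρ) (⟦ l ⟧ ρ)

-- Size and time bounds for terms

sizes : ∀ {n} → Vec Tree n → ℕ
sizes []      = 0
sizes (t ∷ ρ) = size t + sizes ρ

-- The argument is the total size of the environment. In a fold the accumulator starts with the size
-- of `z`, and each of at most `size l` steps adds at most `c` times the value of `s`.
sizeᵖ : ∀ {n} → Term n → Poly
sizeᵖ (var i)            = X
sizeᵖ nil                = con 1
sizeᵖ (t ∙ u)            = con 1 ⊕ (sizeᵖ t ⊕ sizeᵖ u)
sizeᵖ (hd t)             = sizeᵖ t
sizeᵖ (tl t)             = sizeᵖ t
sizeᵖ (ifte t u v)       = sizeᵖ u ⊕ sizeᵖ v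
sizeᵖ (let-in t u)       = sizeᵖ u ⊚ (sizeᵖ t ⊕ X)
sizeᵖ (fold l z s m c _) = sizeᵖ z ⊕ sizeᵖ l ⊗ (con c ⊗ sizeᵖ s ⊚ (sizeᵖ l ⊕ X))

timeᵖ : ∀ {n} → Term n → Poly
timeᵖ (var i)       = X
timeᵖ nil           = con 1
timeᵖ (t ∙ u)       = timeᵖ t ⊕ (timeᵖ u ⊕ sizeᵖ (t ∙ u))
timeᵖ (hd t)        = timeᵖ t ⊕ sizeᵖ t
timeᵖ (tl t)        = timeᵖ t ⊕ sizeᵖ t
timeᵖ (ifte t u v)  = timeᵖ t ⊕ (con 1 ⊕ (timeᵖ u ⊕ timeᵖ v))
timeᵖ (let-in t u)  = timeᵖ t ⊕ (timeᵖ u ⊚ (sizeᵖ t ⊕ X) ⊕ sizeᵖ (let-in t u))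
timeᵖ e@(fold l z s m c _) =
  timeᵖ l ⊕ (timeᵖ z ⊕ (sizeᵖ l ⊗ (con 1 ⊕ step) ⊕ sizeᵖ e))
  where
  -- The body sees a suffix of the list besides the environment. The last two summands of `step` pay
  -- for the two assignments that end the loop body.
  env  = sizeᵖ l ⊕ X
  step = timeᵖ s ⊚ env
       ⊕ (timeᵖ m ⊚ (sizeᵖ s ⊚ env ⊕ (sizeᵖ e ⊕ con 0)) ⊕ (sizeᵖ e ⊕ sizeᵖ l))

size≥1 : ∀ t → 1 ≤ size t
size≥1 nil     = s≤s z≤n
size≥1 (s ∙ t) = s≤s z≤n

size-head : ∀ t → size (head t) ≤ size t
size-head nil     = ≤-refl
size-head (s ∙ t) = m≤n⇒m≤1+n (m≤m+n (size s) (size t))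

size-tail : ∀ t → size (tail t) ≤ size t
size-tail nil     = ≤-refl
size-tail (s ∙ t) = m≤n⇒m≤1+n (m≤n+m (size t) (size s))

size-lookup : ∀ {n} (ρ : Vec Tree n) i → size (Vec.lookup ρ i) ≤ sizes ρ
size-lookup (t ∷ ρ) zero    = m≤m+n (size t) (sizes ρ)
size-lookup (t ∷ ρ) (suc i) = ≤-trans (size-lookup ρ i) (m≤n+m (sizes ρ) (size t))

size-branch : ∀ s t u → size (branch s t u) ≤ size t + size u
size-branch nil     t u = m≤n+m (size u) (size t)
size-branch (_ ∙ _) t u = m≤m+n (size t) (size u)

-- Amortisation: the size of the accumulator plus `b` times the size of the remaining list is a
-- potential that no step increases.
potential-step : ∀ {a a′} b t ts → size a′ ≤ size a + b →
                 size a′ + size ts * b ≤ size a + size (t ∙ ts) * b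
potential-step {a} {a′} b t ts a′≤ = begin
  size a′ + size ts * b              ≤⟨ +-monoˡ-≤ _ a′≤ ⟩
  size a + b + size ts * b           ≡⟨ +-assoc (size a) b _ ⟩
  size a + (b + size ts * b)         ≤⟨ +-monoʳ-≤ (size a) (+-monoʳ-≤ b (*-monoˡ-≤ b (m≤n+m (size ts) (size t)))) ⟩
  size a + size (t ∙ ts) * b         ∎
  where open ≤-Reasoning

size-foldTree : ∀ {f L b} → (∀ x a → size x ≤ L → size (f x a) ≤ size a + b) →
                ∀ a l → size l ≤ L → size (foldTree f a l) ≤ size a + size l * b
size-foldTree step a nil      _   = m≤m+n (size a) _
size-foldTree {f} {L} {b} step a (t ∙ ts) l≤L =
  ≤-trans (size-foldTree step (f (t ∙ ts) a) ts (≤-trans (size-tail (t ∙ ts)) l≤L))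
          (potential-step b t ts (step (t ∙ ts) a l≤L))

size-⟦⟧ : ∀ {n} (t : Term n) ρ → size (⟦ t ⟧ ρ) ≤ evalᵖ (sizeᵖ t) (sizes ρ)
size-⟦⟧ (var i)      ρ = size-lookup ρ i
size-⟦⟧ nil          ρ = ≤-refl
size-⟦⟧ (t ∙ u)      ρ = s≤s (+-mono-≤ (size-⟦⟧ t ρ) (size-⟦⟧ u ρ))
size-⟦⟧ (hd t)       ρ = ≤-trans (size-head (⟦ t ⟧ ρ)) (size-⟦⟧ t ρ)
size-⟦⟧ (tl t)       ρ = ≤-trans (size-tail (⟦ t ⟧ ρ)) (size-⟦⟧ t ρ)
size-⟦⟧ (ifte t u v) ρ =
  ≤-trans (size-branch (⟦ t ⟧ ρ) (⟦ u ⟧ ρ) (⟦ v ⟧ ρ)) (+-mono-≤ (size-⟦⟧ u ρ) (size-⟦⟧ v ρ))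
size-⟦⟧ (let-in t u) ρ =
  ≤-trans (size-⟦⟧ u (⟦ t ⟧ ρ ∷ ρ)) (evalᵖ-mono (sizeᵖ u) (+-monoˡ-≤ (sizes ρ) (size-⟦⟧ t ρ)))
size-⟦⟧ (fold l z s m c growth) ρ =
  ≤-trans (size-foldTree (λ x a x≤L → ≤-trans (growth (⟦ s ⟧ (x ∷ ρ)) a) (+-monoʳ-≤ (size a) (*-monoʳ-≤ c
             (≤-trans (size-⟦⟧ s (x ∷ ρ)) (evalᵖ-mono (sizeᵖ s) (+-monoˡ-≤ (sizes ρ) x≤L))))))
             (⟦ z ⟧ ρ) (⟦ l ⟧ ρ) (size-⟦⟧ l ρ))
          (+-mono-≤ (size-⟦⟧ z ρ) (*-monoˡ-≤ _ (size-⟦⟧ l ρ)))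

-- Compilation to WHILE

-- compile t ν b reads its free variables from ν, leaves the result in b and
-- writes no variable below b.
compile : ∀ {n} → Term n → Vec Var n → Var → Cmd
compile (var i)            ν b = b ≔ var (Vec.lookup ν i)
compile nil                ν b = b ≔ nil
compile (t ∙ u)            ν b =
  compile t ν b ⨾ compile u ν (suc b) ⨾ b ≔ cons (var b) (var (suc b))
compile (hd t)             ν b = compile t ν b ⨾ b ≔ hd (var b)
compile (tl t)             ν b = compile t ν b ⨾ b ≔ tl (var b)
compile (ifte t u v)       ν b =
  compile t ν b ⨾ if var b then compile u ν b else compile v ν b
compile (let-in t u)       ν b =
  compile t ν b ⨾ compile u (b ∷ ν) (suc b) ⨾ b ≔ var (suc b)
compile (fold l z s m _ _) ν b =
  compile l ν b ⨾ compile z ν (suc b) ⨾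
  (while var b loop
     (compile s (b ∷ ν) (2 + b) ⨾ compile m (2 + b ∷ suc b ∷ []) (3 + b) ⨾
      suc b ≔ var (3 + b) ⨾ b ≔ tl (var b))) ⨾
  b ≔ var (suc b)

-- Stores and timed runs of commands

update-same : ∀ σ x t → (σ [ x ↦ t ]) x ≡ t
update-same σ zero    t = refl
update-same σ (suc x) t = update-same (σ ∘ suc) x t

update-other : ∀ σ {x y} t → x ≢ y → (σ [ x ↦ t ]) y ≡ σ y
update-other σ {x} {y} t x≢y with x ≡ᵇ y | ≡ᵇ⇒≡ x y
... | true  | eq = contradiction (eq _) x≢y
... | false | _  = refl

infix 4 _≈[_]_

_≈[_]_ : Store → Var → Store → Set
τ ≈[ b ] σ = ∀ {y} → y < b → τ y ≡ σ y

update-≈ : ∀ {σ τ b x t} → τ ≈[ b ] σ → b ≤ x → τ [ x ↦ t ] ≈[ b ] σ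
update-≈ {τ = τ} {t = t} τ≈σ b≤x y<b =
  trans (update-other τ t (>⇒≢ (<-≤-trans y<b b≤x))) (τ≈σ y<b)

map-≈ : ∀ {n σ τ b} {ν : Vec Var n} → All (_< b) ν → τ ≈[ b ] σ → Vec.map τ ν ≡ Vec.map σ ν
map-≈ []       τ≈σ = refl
map-≈ (p ∷ ps) τ≈σ = cong₂ _∷_ (τ≈σ p) (map-≈ ps τ≈σ)

record Runs (c : Cmd) (σ : Store) (b x : Var) (r : Tree) (bound : ℕ) : Set where
  field
    {final} : Store
    {time}  : ℕ
    run     : ⟨ c , σ ⟩⇓⟨ final , time ⟩
    result  : final x ≡ r
    frame   : final ≈[ b ] σ
    time≤   : time ≤ bound

open Runs

assigns : ∀ {σ b x e r n} → b ≤ x → eval e σ ≡ r → size r ≤ n → Runs (x ≔ e) σ b x r n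
assigns {σ} {b} {x} {e} b≤x eq r≤n = record
  { run    = assign
  ; result = trans (update-same σ x (eval e σ)) eq
  ; frame  = update-≈ {σ} {σ} (λ _ → refl) b≤x
  ; time≤  = ≤-trans (≤-reflexive (cong size eq)) r≤n
  }

infixr 5 _⟫_

_⟫_ : ∀ {c d σ b x y r s m n} (p : Runs c σ b x r m) → Runs d (final p) b y s n →
      Runs (c ⨾ d) σ b y s (m + n)
p ⟫ q = record
  { run    = seq (run p) (run q)
  ; result = result q
  ; frame  = λ y<b → trans (frame q y<b) (frame p y<b)
  ; time≤  = +-mono-≤ (time≤ p) (time≤ q)
  }

lower : ∀ {c σ b b′ x r n} → b ≤ b′ → Runs c σ b′ x r n → Runs c σ b x r n
lower b≤b′ p = record
  { run = run p; result = result p; frame = λ y<b → frame p (<-≤-trans y<b b≤b′); time≤ = time≤ p }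

relax : ∀ {c σ b x r m n} → m ≤ n → Runs c σ b x r m → Runs c σ b x r n
relax m≤n p = record
  { run = run p; result = result p; frame = frame p; time≤ = ≤-trans (time≤ p) m≤n }

reroute : ∀ {c σ b x y r s n} (p : Runs c σ b x r n) → final p y ≡ s → Runs c σ b y s n
reroute p eq = record { run = run p; result = eq; frame = frame p; time≤ = time≤ p }

runs-if : ∀ {c d σ b x r s t m n} → σ x ≡ r →
          Runs c σ b b s m → Runs d σ b b t n →
          Runs (if var x then c else d) σ b b (branch r s t) (suc (m + n))
runs-if {r = nil}   {m = m} {n} eq p q = record
  { run = if-false eq (run q); result = result q; frame = frame q
  ; time≤ = s≤s (≤-trans (time≤ q) (m≤n+m n m)) }
runs-if {r = _ ∙ _} {m = m} {n} eq p q = record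
  { run = if-true (λ eq′ → contradiction (trans (sym eq) eq′) λ ()) (run p)
  ; result = result p; frame = frame p
  ; time≤ = s≤s (≤-trans (time≤ p) (m≤m+n m n)) }

widen : ∀ {n b c} {ν : Vec Var n} → b ≤ c → All (_< b) ν → All (_< c) ν
widen b≤c = All.map (λ y<b → <-≤-trans y<b b≤c)

-- The potential never exceeds `S`, so every accumulator has size at most `S` and one bound `T`
-- serves all iterations. As `nil` has size 1, `size r` also counts the final failing test.
runs-while : ∀ {c b σ f L S B T} →
  (∀ x a → size x ≤ L → size (f x a) ≤ size a + B) →
  (∀ {τ a} t ts → τ ≈[ b ] σ → τ b ≡ t ∙ ts → τ (suc b) ≡ a →
     size (t ∙ ts) ≤ L → size a ≤ S → size (f (t ∙ ts) a) ≤ S →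
     Σ[ p ∈ Runs c τ b (suc b) (f (t ∙ ts) a) T ] final p b ≡ ts) →
  ∀ {τ a} r → τ ≈[ b ] σ → τ b ≡ r → τ (suc b) ≡ a →
  size r ≤ L → size a + size r * B ≤ S →
  Runs (while var b loop c) τ b (suc b) (foldTree f a r) (size r * suc T)
runs-while {T = T} growth body nil τ≈σ τb τa r≤L a≤S = record
  { run = while-false τb; result = τa; frame = λ _ → refl; time≤ = s≤s z≤n }
runs-while {b = b} {f = f} {B = B} {T = T} growth body {τ} {a} (t ∙ ts) τ≈σ τb τa r≤L a≤S =
  let a′≤S   = ≤-trans (potential-step B t ts (growth (t ∙ ts) a r≤L)) a≤S
      p , pb = body t ts τ≈σ τb τa r≤L (≤-trans (m≤m+n _ _) a≤S) (≤-trans (m≤m+n _ _) a′≤S)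
      q      = runs-while growth body ts (λ y<b → trans (frame p y<b) (τ≈σ y<b)) pb (result p)
                 (≤-trans (size-tail (t ∙ ts)) r≤L) a′≤S
  in record
  { run    = while-true (λ eq → contradiction (trans (sym τb) eq) λ ()) (run p) (run q)
  ; result = result q
  ; frame  = λ y<b → trans (frame q y<b) (frame p y<b)
  ; time≤  = s≤s (+-mono-≤ (time≤ p) (≤-trans (time≤ q) (*-monoˡ-≤ (suc T) (m≤n+m (size ts) (size t)))))
  }

-- All of `ν` lies below `b`, so by the frame condition the free variables still hold their values
-- when the next subterm starts.
compile-runs : ∀ {n} (t : Term n) {ν b σ ρ} → All (_< b) ν → Vec.map σ ν ≡ ρ →
               Runs (compile t ν b) σ b b (⟦ t ⟧ ρ) (evalᵖ (timeᵖ t) (sizes ρ))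
compile-runs (var i) {ν} {σ = σ} {ρ} ν<b refl =
  assigns ≤-refl (sym (lookup-map i σ ν)) (size-lookup ρ i)
compile-runs nil ν<b eq = assigns ≤-refl refl ≤-refl
compile-runs (t ∙ u) {ν} {b} {σ} {ρ} ν<b eq =
  p ⟫ lower (n≤1+n b) q ⟫
  assigns ≤-refl (cong₂ _∙_ (trans (frame q (n<1+n b)) (result p)) (result q)) (size-⟦⟧ (t ∙ u) ρ)
  where
  p = compile-runs t ν<b eq
  q = compile-runs u {b = suc b} (widen (n≤1+n b) ν<b) (trans (map-≈ ν<b (frame p)) eq)
compile-runs (hd t) {ρ = ρ} ν<b eq =
  let p = compile-runs t ν<b eq
  in p ⟫ assigns ≤-refl (cong head (result p)) (size-⟦⟧ (hd t) ρ)
compile-runs (tl t) {ρ = ρ} ν<b eq =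
  let p = compile-runs t ν<b eq
  in p ⟫ assigns ≤-refl (cong tail (result p)) (size-⟦⟧ (tl t) ρ)
compile-runs (ifte t u v) ν<b eq =
  let p   = compile-runs t ν<b eq
      eq′ = trans (map-≈ ν<b (frame p)) eq
  in p ⟫ runs-if (result p) (compile-runs u ν<b eq′) (compile-runs v ν<b eq′)
compile-runs (let-in t u) {ν} {b} {σ} {ρ} ν<b eq =
  p ⟫ lower (n≤1+n b) (relax q≤ q) ⟫
  assigns ≤-refl (result q) (size-⟦⟧ (let-in t u) ρ)
  where
  p  = compile-runs t ν<b eq
  q  = compile-runs u {b = suc b} (n<1+n b ∷ widen (n≤1+n b) ν<b)
         (cong₂ _∷_ (result p) (trans (map-≈ ν<b (frame p)) eq))
  q≤ = evalᵖ-mono (timeᵖ u) (+-monoˡ-≤ (sizes ρ) (size-⟦⟧ t ρ))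
compile-runs e@(fold l z s m c growth) {ν} {b} {σ} {ρ} ν<b eq =
  p ⟫ lower (n≤1+n b) q ⟫ relax loop≤ loop ⟫
  assigns ≤-refl (result loop) (size-⟦⟧ e ρ)
  where
  L E V S C : ℕ
  L = evalᵖ (sizeᵖ l) (sizes ρ)
  E = L + sizes ρ
  V = evalᵖ (sizeᵖ s) E
  S = evalᵖ (sizeᵖ e) (sizes ρ)
  C = evalᵖ (timeᵖ s) E + (evalᵖ (timeᵖ m) (V + (S + 0)) + (S + L))

  f : Tree → Tree → Tree
  f x a = ⟦ m ⟧ (⟦ s ⟧ (x ∷ ρ) ∷ a ∷ [])

  value≤V : ∀ x → size x ≤ L → size (⟦ s ⟧ (x ∷ ρ)) ≤ V
  value≤V x x≤L = ≤-trans (size-⟦⟧ s (x ∷ ρ)) (evalᵖ-mono (sizeᵖ s) (+-monoˡ-≤ (sizes ρ) x≤L))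

  p = compile-runs l ν<b eq
  q = compile-runs z {b = suc b} (widen (n≤1+n b) ν<b) (trans (map-≈ ν<b (frame p)) eq)

  body : ∀ {τ a} t ts → τ ≈[ b ] σ → τ b ≡ t ∙ ts → τ (suc b) ≡ a →
         size (t ∙ ts) ≤ L → size a ≤ S → size (f (t ∙ ts) a) ≤ S →
         Σ[ p ∈ Runs _ τ b (suc b) (f (t ∙ ts) a) C ] final p b ≡ ts
  body {τ} {a} t ts τ≈σ τb τa x≤L a≤S a′≤S =
    -- The last assignment writes the tail to `b` and leaves the new accumulator in `suc b`
    -- untouched.
    reroute iter (trans (update-other (final r₃) _ b≢1+b) (result r₃)) , result iter
    where
    x = t ∙ ts
    b≢1+b : b ≢ suc b
    b≢1+b = ≢-sym 1+n≢n
    b<3+b : b < 3 + b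
    b<3+b = m≤n+m (suc b) 2
    r₁ = compile-runs s {b = 2 + b} (m≤n+m (suc b) 1 ∷ widen (m≤n+m b 2) ν<b)
           (cong₂ _∷_ τb (trans (map-≈ ν<b τ≈σ) eq))
    r₂ = compile-runs m {2 + b ∷ suc b ∷ []} {3 + b} (≤-refl ∷ n≤1+n _ ∷ [])
           (cong₂ _∷_ (result r₁) (cong (_∷ []) (trans (frame r₁ ≤-refl) τa)))
    τ₂b : final r₂ b ≡ x
    τ₂b = trans (frame r₂ b<3+b) (trans (frame r₁ (m≤n+m (suc b) 1)) τb)
    r₃ = assigns {σ = final r₂} {b = b} {x = suc b} {e = var (3 + b)} (n≤1+n b) (result r₂) a′≤S
    τ₃b : final r₃ b ≡ x
    τ₃b = trans (update-other (final r₂) _ 1+n≢n) τ₂b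
    r₄ = assigns {σ = final r₃} {b = b} {x = b} {e = tl (var b)} ≤-refl (cong tail τ₃b)
           (≤-trans (size-tail x) x≤L)
    iter = lower (m≤n+m b 2) (relax (evalᵖ-mono (timeᵖ s) (+-monoˡ-≤ (sizes ρ) x≤L)) r₁) ⟫
           lower (m≤n+m b 3) (relax (evalᵖ-mono (timeᵖ m) (+-mono-≤ (value≤V x x≤L) (+-monoˡ-≤ 0 a≤S))) r₂) ⟫
           r₃ ⟫ r₄

  loop = runs-while {f = f} {L} {S} {evalᵖ (con c ⊗ sizeᵖ s ⊚ (sizeᵖ l ⊕ X)) (sizes ρ)} {C}
    (λ x a x≤L → ≤-trans (growth (⟦ s ⟧ (x ∷ ρ)) a) (+-monoʳ-≤ (size a) (*-monoʳ-≤ c (value≤V x x≤L))))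
    body (⟦ l ⟧ ρ) (λ y<b → trans (frame q (m≤n⇒m≤1+n y<b)) (frame p y<b))
    (trans (frame q (n<1+n b)) (result p)) (result q) (size-⟦⟧ l ρ)
    (+-mono-≤ (size-⟦⟧ z ρ) (*-monoˡ-≤ _ (size-⟦⟧ l ρ)))
  loop≤ = *-monoˡ-≤ (suc C) (size-⟦⟧ l ρ)

program : Term 1 → Cmd
program t = compile t (0 ∷ []) 1 ⨾ 0 ≔ var 1

program-maps : ∀ t s → program t maps s to ⟦ t ⟧ (s ∷ []) within
               evalᵖ (timeᵖ t ⊕ sizeᵖ t) (size s + 0)
program-maps t s = final p , time p , run p , result p , time≤ p
  where
  q = compile-runs t {0 ∷ []} {1} {initial s} (s≤s z≤n ∷ []) refl
  p = lower {b = 0} z≤n q ⟫ assigns {x = 0} ≤-refl (result q) (size-⟦⟧ t (s ∷ []))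

-- The exponent is astronomically large and must never be unfolded.
abstract
  exponentᵗ : Term 1 → ℕ
  exponentᵗ t = degree (timeᵖ t ⊕ sizeᵖ t)

  program-maps-^ : ∀ t s → 2 ≤ size s → program t maps s to ⟦ t ⟧ (s ∷ []) within (1 * size s ^ exponentᵗ t)
  program-maps-^ t s 2≤s =
    let τ , n , run , result , n≤ = program-maps t s
    in τ , n , run , result , (begin
      n                         ≤⟨ n≤ ⟩
      evalᵖ p (size s + 0)      ≡⟨ cong (evalᵖ p) (+-identityʳ (size s)) ⟩
      evalᵖ p (size s)          ≤⟨ evalᵖ≤^ p 2≤s ⟩
      size s ^ degree p         ≡⟨ *-identityˡ (size s ^ degree p) ⟨
      1 * size s ^ degree p     ∎)
    where
    open ≤-Reasoning
    p : Poly
    p = timeᵖ t ⊕ sizeᵖ t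

-- Programming with lists and unary numbers

_++ᵗ_ : Tree → Tree → Tree
nil     ++ᵗ u = u
(s ∙ t) ++ᵗ u = s ∙ (t ++ᵗ u)

flatᵗ : (Tree → Tree) → Tree → Tree
flatᵗ f nil     = nil
flatᵗ f (s ∙ t) = f (s ∙ t) ++ᵗ flatᵗ f t

revOntoᵗ : Tree → Tree → Tree
revOntoᵗ t u = foldTree (λ x a → head x ∙ a) u t

len : Tree → ℕ
len nil     = 0
len (s ∙ t) = suc (len t)

revOnto-size : ∀ t u → size (revOntoᵗ t u) ≤ size u + size t
revOnto-size nil     u = m≤m+n (size u) 1
revOnto-size (s ∙ t) u = ≤-trans (revOnto-size t (s ∙ u)) (≤-reflexive
  (solve 3 (λ s t u → (con 1 :+ (s :+ u)) :+ t := u :+ (con 1 :+ (s :+ t))) refl (size s) (size t) (size u)))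

revOnto-++ : ∀ s t u → revOntoᵗ (s ++ᵗ t) u ≡ revOntoᵗ t (revOntoᵗ s u)
revOnto-++ nil      t u = refl
revOnto-++ (r ∙ s) t u = revOnto-++ s t (r ∙ u)

revOnto-revOnto : ∀ s t u → revOntoᵗ (revOntoᵗ s t) u ≡ revOntoᵗ t (s ++ᵗ u)
revOnto-revOnto nil     t u = refl
revOnto-revOnto (r ∙ s) t u = revOnto-revOnto s (r ∙ t) u

++ᵗ-identityʳ : ∀ t → t ++ᵗ nil ≡ t
++ᵗ-identityʳ nil     = refl
++ᵗ-identityʳ (s ∙ t) = cong (s ∙_) (++ᵗ-identityʳ t)

revOnto : ∀ {n} → Term n → Term n → Term n
revOnto t u = fold t u (hd (var (# 0))) (var (# 0) ∙ var (# 1)) 2 λ v a →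
  ≤-trans (s≤s (m≤m+n (size v + size a) 0))
    (≤-trans (+-monoˡ-≤ (size v + size a + 0) (size≥1 v))
      (≤-reflexive (solve 2 (λ v a → v :+ (v :+ a :+ con 0) := a :+ con 2 :* v) refl (size v) (size a))))

rev : ∀ {n} → Term n → Term n
rev t = revOnto t nil

append : ∀ {n} → Term n → Term n → Term n
append t u = revOnto (rev t) u

-- Each piece is reversed onto the accumulator, which grows only by the piece; the final `rev`
-- restores the order of the pieces and the order inside them.
flat : ∀ {n} → Term n → Term (suc n) → Term n
flat t u = rev (fold t nil u (revOnto (var (# 0)) (var (# 1))) 1 λ v a →
  ≤-trans (revOnto-size v a) (≤-reflexive (cong (size a +_) (sym (+-identityʳ (size v))))))

⟦append⟧ : ∀ {n} (t u : Term n) ρ → ⟦ append t u ⟧ ρ ≡ ⟦ t ⟧ ρ ++ᵗ ⟦ u ⟧ ρ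
⟦append⟧ t u ρ = revOnto-revOnto (⟦ t ⟧ ρ) nil (⟦ u ⟧ ρ)

⟦flat⟧ : ∀ {n} (t : Term n) u ρ → ⟦ flat t u ⟧ ρ ≡ flatᵗ (λ x → ⟦ u ⟧ (x ∷ ρ)) (⟦ t ⟧ ρ)
⟦flat⟧ t u ρ = trans (cong (λ s → revOntoᵗ s nil) (go (⟦ t ⟧ ρ) nil))
                     (trans (revOnto-revOnto (flatᵗ _ (⟦ t ⟧ ρ)) nil nil) (++ᵗ-identityʳ _))
  where
  f : Tree → Tree
  f x = ⟦ u ⟧ (x ∷ ρ)
  go : ∀ l a → foldTree (λ x a → revOntoᵗ (f x) a) a l ≡ revOntoᵗ (flatᵗ f l) a
  go nil     a = refl
  go (s ∙ l) a = trans (go l (revOntoᵗ (f (s ∙ l)) a)) (sym (revOnto-++ (f (s ∙ l)) (flatᵗ f l) a))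

true′ : ∀ {n} → Term n
true′ = nil ∙ nil

-- One cell of `t` is dropped for every cell of `u`; the comparison holds iff nothing is left.
le : ∀ {n} → Term n → Term n → Term n
le t u = ifte (fold u t nil (tl (var (# 1))) 0 λ v a → ≤-trans (size-tail a) (m≤m+n (size a) 0)) nil true′

and or : ∀ {n} → Term n → Term n → Term n
and t u = ifte t u nil
or  t u = ifte t true′ u

-- Wrapping the equation lets Agda read off ρ and t.
infix 3 _⊢_⇓_

record _⊢_⇓_ {n} (ρ : Vec Tree n) (t : Term n) (v : Tree) : Set where
  constructor den
  field value : ⟦ t ⟧ ρ ≡ v

open _⊢_⇓_

⇓-cons : ∀ {n} {t u : Term n} {ρ v w} → ρ ⊢ t ⇓ v → ρ ⊢ u ⇓ w → ρ ⊢ t ∙ u ⇓ v ∙ w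
⇓-cons (den p) (den q) = den (cong₂ _∙_ p q)

⇓-single : ∀ {n} {t : Term n} {ρ v} → ρ ⊢ t ⇓ v → ρ ⊢ t ∙ nil ⇓ v ∙ nil
⇓-single p = ⇓-cons p (den refl)

⇓-let-in : ∀ {n} {t : Term n} {u ρ v w} → ρ ⊢ t ⇓ v → (v ∷ ρ) ⊢ u ⇓ w → ρ ⊢ let-in t u ⇓ w
⇓-let-in (den refl) (den q) = den q

⇓-le : ∀ {n} {t u : Term n} {ρ a b} → len (⟦ t ⟧ ρ) ≡ a → len (⟦ u ⟧ ρ) ≡ b →
       ρ ⊢ le t u ⇓ encodeBool (a ≤ᵇ b)
⇓-le {t = t} {u} {ρ} refl refl = den (go (⟦ t ⟧ ρ) (⟦ u ⟧ ρ))
  where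
  ≤ᵇ-suc : ∀ m n → (m <ᵇ suc n) ≡ (m ≤ᵇ n)
  ≤ᵇ-suc zero    n = refl
  ≤ᵇ-suc (suc m) n = refl
  go : ∀ s t → branch (foldTree (λ _ a → tail a) s t) nil (nil ∙ nil) ≡ encodeBool (len s ≤ᵇ len t)
  go nil     nil     = refl
  go (_ ∙ _) nil     = refl
  go nil     (_ ∙ t) = go nil t
  go (_ ∙ s) (_ ∙ t) = trans (go s t) (cong encodeBool (sym (≤ᵇ-suc (len s) (len t))))

⇓-and : ∀ {n} {t u : Term n} {ρ a b} → ρ ⊢ t ⇓ encodeBool a → ρ ⊢ u ⇓ encodeBool b →
        ρ ⊢ and t u ⇓ encodeBool (a ∧ b)
⇓-and {a = true}  (den p) (den q) = den (trans (cong (λ v → branch v _ nil) p) q)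
⇓-and {a = false} (den p) (den q) = den (cong (λ v → branch v _ nil) p)

⇓-or : ∀ {n} {t u : Term n} {ρ a b} → ρ ⊢ t ⇓ encodeBool a → ρ ⊢ u ⇓ encodeBool b →
       ρ ⊢ or t u ⇓ encodeBool (a ∨ b)
⇓-or {a = true}  (den p) (den q) = den (cong (λ v → branch v (nil ∙ nil) _) p)
⇓-or {a = false} (den p) (den q) = den (trans (cong (λ v → branch v (nil ∙ nil) _) p) q)

encodeUnary-+ : ∀ m n → encodeUnary m ++ᵗ encodeUnary n ≡ encodeUnary (m + n)
encodeUnary-+ zero    n = refl
encodeUnary-+ (suc m) n = cong (nil ∙_) (encodeUnary-+ m n)

len-encodeUnary : ∀ n → len (encodeUnary n) ≡ n
len-encodeUnary zero    = refl
len-encodeUnary (suc n) = cong suc (len-encodeUnary n)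

module _ {A : Set} (e : A → Tree) where

  encodeList-++ : ∀ xs ys → encodeList e xs ++ᵗ encodeList e ys ≡ encodeList e (xs ++ ys)
  encodeList-++ []       ys = refl
  encodeList-++ (x ∷ xs) ys = cong (e x ∙_) (encodeList-++ xs ys)

  len-encodeList : ∀ xs → len (encodeList e xs) ≡ length xs
  len-encodeList []       = refl
  len-encodeList (x ∷ xs) = cong suc (len-encodeList xs)

⇓-add : ∀ {n} {t u : Term n} {ρ a b} → ρ ⊢ t ⇓ encodeUnary a → ρ ⊢ u ⇓ encodeUnary b →
        ρ ⊢ append t u ⇓ encodeUnary (a + b)
⇓-add {t = t} {u} {ρ} {a} {b} (den p) (den q) =
  den (trans (⟦append⟧ t u ρ) (trans (cong₂ _++ᵗ_ p q) (encodeUnary-+ a b)))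

⇓-append : ∀ {A : Set} {e : A → Tree} {n} {t u : Term n} {ρ xs ys} →
  ρ ⊢ t ⇓ encodeList e xs → ρ ⊢ u ⇓ encodeList e ys → ρ ⊢ append t u ⇓ encodeList e (xs ++ ys)
⇓-append {e = e} {t = t} {u} {ρ} {xs} {ys} (den p) (den q) =
  den (trans (⟦append⟧ t u ρ) (trans (cong₂ _++ᵗ_ p q) (encodeList-++ e xs ys)))

lengthᵗ : ∀ {n} → Term n → Term n
lengthᵗ t = flat t true′

⇓-length : ∀ {n} {t : Term n} {ρ a} → len (⟦ t ⟧ ρ) ≡ a → ρ ⊢ lengthᵗ t ⇓ encodeUnary a
⇓-length {t = t} {ρ} refl = den (trans (⟦flat⟧ t true′ ρ) (go (⟦ t ⟧ ρ)))
  where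
  go : ∀ l → flatᵗ (λ _ → nil ∙ nil) l ≡ encodeUnary (len l)
  go nil     = refl
  go (_ ∙ l) = cong (nil ∙_) (go l)

ranked : ∀ {A : Set} → List A → List (A × ℕ)
ranked []       = []
ranked (x ∷ xs) = (x , length xs) ∷ ranked xs

-- A loop over n vertices sees n − 1 − u of them after u, which serves as label.
rank : ∀ {n} → Fin n → ℕ
rank u = toℕ (opposite u)

ranked-tabulate : ∀ {A : Set} {n} (f : Fin n → A) → ranked (tabulate f) ≡ tabulate (λ u → f u , rank u)
ranked-tabulate {n = zero}  f = refl
ranked-tabulate {n = suc n} f = cong₂ _∷_
  (cong (f zero ,_) (trans (length-tabulate (f ∘ suc)) (sym (toℕ-fromℕ n))))
  (trans (ranked-tabulate (f ∘ suc)) (tabulate-cong λ u → cong (f (suc u) ,_) (sym (opposite-suc u))))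

module _ {n} {t : Term n} {u : Term (suc n)} {ρ : Vec Tree n} where

  private
    f : Tree → Tree
    f x = ⟦ u ⟧ (x ∷ ρ)

    flat-on : ∀ {v w} → ρ ⊢ t ⇓ v → flatᵗ f v ≡ w → ρ ⊢ flat t u ⇓ w
    flat-on (den refl) eq = den (trans (⟦flat⟧ t u ρ) eq)

  ⇓-mul : ∀ {a b} → ρ ⊢ t ⇓ encodeUnary a → (∀ x → (x ∷ ρ) ⊢ u ⇓ encodeUnary b) →
          ρ ⊢ flat t u ⇓ encodeUnary (a * b)
  ⇓-mul {a} {b} p q = flat-on p (go a)
    where
    go : ∀ a → flatᵗ f (encodeUnary a) ≡ encodeUnary (a * b)
    go zero    = refl
    go (suc a) = trans (cong₂ _++ᵗ_ (value (q _)) (go a)) (encodeUnary-+ b (a * b))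

  module _ {B : Set} {e′ : B → Tree} where

    ⇓-downFrom : ∀ {a} {g : ℕ → List B} → ρ ⊢ t ⇓ encodeUnary a →
      (∀ i → (encodeUnary (suc i) ∷ ρ) ⊢ u ⇓ encodeList e′ (g i)) →
      ρ ⊢ flat t u ⇓ encodeList e′ (concatMap g (downFrom a))
    ⇓-downFrom {a} {g} p q = flat-on p (go a)
      where
      go : ∀ a → flatᵗ f (encodeUnary a) ≡ encodeList e′ (concatMap g (downFrom a))
      go zero    = refl
      go (suc a) = trans (cong₂ _++ᵗ_ (value (q a)) (go a)) (encodeList-++ e′ (g a) _)

    module _ {A : Set} {e : A → Tree} where

      ⇓-ranked : ∀ {xs} {g : A × ℕ → List B} → ρ ⊢ t ⇓ encodeList e xs →
        (∀ x xs → (encodeList e (x ∷ xs) ∷ ρ) ⊢ u ⇓ encodeList e′ (g (x , length xs))) →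
        ρ ⊢ flat t u ⇓ encodeList e′ (concatMap g (ranked xs))
      ⇓-ranked {xs} {g} p q = flat-on p (go xs)
        where
        go : ∀ xs → flatᵗ f (encodeList e xs) ≡ encodeList e′ (concatMap g (ranked xs))
        go []       = refl
        go (x ∷ xs) = trans (cong₂ _++ᵗ_ (value (q x xs)) (go xs)) (encodeList-++ e′ (g (x , length xs)) _)

      ⇓-concatMap : ∀ {xs} {g : A → List B} → ρ ⊢ t ⇓ encodeList e xs →
        (∀ x xs → (encodeList e (x ∷ xs) ∷ ρ) ⊢ u ⇓ encodeList e′ (g x)) →
        ρ ⊢ flat t u ⇓ encodeList e′ (concatMap g xs)
      ⇓-concatMap {xs} {g} p q = flat-on p (go xs)
        where
        go : ∀ xs → flatᵗ f (encodeList e xs) ≡ encodeList e′ (concatMap g xs)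
        go []       = refl
        go (x ∷ xs) = trans (cong₂ _++ᵗ_ (value (q x xs)) (go xs)) (encodeList-++ e′ (g x) _)

      -- A loop does not see the index `v`, only the entry and the number of entries after it, which
      -- is `rank v`; `h` is the output in these terms.
      ⇓-tabulate : ∀ {m} {f : Fin m → A} {g : Fin m → B} (h : A → ℕ → Tree) → ρ ⊢ t ⇓ encodeList e (tabulate f) →
        (∀ x xs → (encodeList e (x ∷ xs) ∷ ρ) ⊢ u ⇓ h x (length xs) ∙ nil) →
        (∀ v → h (f v) (rank v) ≡ e′ (g v)) →
        ρ ⊢ flat t u ⇓ encodeList e′ (tabulate g)
      ⇓-tabulate h p q r = flat-on p (go r)
        where
        go : ∀ {m} {f′ : Fin m → A} {g : Fin m → B} → (∀ v → h (f′ v) (rank v) ≡ e′ (g v)) →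
             flatᵗ f (encodeList e (tabulate f′)) ≡ encodeList e′ (tabulate g)
        go {zero}           r = refl
        go {suc m} {f′} {g} r = cong₂ _++ᵗ_
          (trans (value (q _ _)) (cong (_∙ nil)
            (trans (cong (h (f′ zero)) (trans (length-tabulate (f′ ∘ suc)) (sym (toℕ-fromℕ m)))) (r zero))))
          (go (λ v → trans (cong (h (f′ (suc v))) (sym (opposite-suc v))) (r (suc v))))

-- Binary numerals

-- One step of the increment in bijective base 2: the accumulator is a carry
-- together with the digits written so far, in reverse.
carry : Term 2
carry = ifte (hd acc) (ifte digit (true′ ∙ (nil ∙ tl acc)) (nil ∙ (true′ ∙ tl acc)))
                      (nil ∙ (digit ∙ tl acc))
  where digit = var (# 0)
        acc   = var (# 1)

carry-size : ∀ v a → size (⟦ carry ⟧ (v ∷ a ∷ [])) ≤ size a + 6 * size v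
carry-size v a = ≤-trans (case a v) (+-mono-≤ (size-tail a) (aux v))
  where
  aux : ∀ v → 5 + size v ≤ 6 * size v
  aux v = ≤-trans (+-monoˡ-≤ (size v) (*-monoʳ-≤ 5 (size≥1 v))) (≤-reflexive (+-comm (5 * size v) (size v)))
  aux₁ : ∀ v t → 6 + size t ≤ size t + (5 + size v)
  aux₁ v t = ≤-trans (≤-reflexive (+-comm 6 (size t))) (+-monoʳ-≤ (size t) (+-monoʳ-≤ 5 (size≥1 v)))
  case : ∀ a v → size (⟦ carry ⟧ (v ∷ a ∷ [])) ≤ size (tail a) + (5 + size v)
  aux₂ : ∀ v t → 3 + (size v + size t) ≤ size t + (5 + size v)
  aux₂ v t = ≤-trans (+-monoˡ-≤ (size v + size t) (m≤m+n 3 2))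
    (≤-reflexive (solve 2 (λ v t → con 5 :+ (v :+ t) := t :+ (con 5 :+ v)) refl (size v) (size t)))
  case nil           v       = aux₂ v nil
  case (nil ∙ t)     v       = aux₂ v t
  case ((_ ∙ _) ∙ t) nil     = aux₁ nil t
  case ((_ ∙ _) ∙ t) (r ∙ s) = aux₁ (r ∙ s) t

-- The fold starts with the carry set. A carry left at the end becomes a new most significant digit
-- 1, encoded by `nil`, before the digits are put back in order.
increment : ∀ {n} → Term n → Term n
increment t = let-in (fold t (true′ ∙ nil) (hd (var (# 0))) carry 6 carry-size)
                     (rev (ifte (hd (var (# 0))) (nil ∙ tl (var (# 0))) (tl (var (# 0)))))

module _ where
  private
    runCarry : Tree → Tree → Tree
    runCarry a l = foldTree (λ x a → ⟦ carry ⟧ (head x ∷ a ∷ [])) a l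

    finish : Tree → Tree
    finish s = revOntoᵗ (branch (head s) (nil ∙ tail s) (tail s)) nil

  -- The growth condition of a fold quantifies over all trees, so the size bounds cannot assume that
  -- `l` encodes a numeral or that a set carry is `nil ∙ nil`.
  finish-runCarry-size₀ : ∀ l o → size (finish (runCarry (nil ∙ o) l)) ≤ size o + size l
  finish-runCarry-size₀ nil     o = ≤-trans (revOnto-size o nil) (≤-reflexive (+-comm 1 (size o)))
  finish-runCarry-size₀ (d ∙ l) o = ≤-trans (finish-runCarry-size₀ l (d ∙ o)) (≤-reflexive
    (solve 3 (λ d l o → con 1 :+ (d :+ o) :+ l := o :+ (con 1 :+ (d :+ l))) refl (size d) (size l) (size o)))

  finish-runCarry-size₁ : ∀ l c c′ o → size (finish (runCarry ((c ∙ c′) ∙ o) l)) ≤ size o + (size l + 2)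
  finish-runCarry-size₁ nil           c c′ o =
    ≤-trans (revOnto-size (nil ∙ o) nil) (≤-reflexive (+-comm 3 (size o)))
  finish-runCarry-size₁ (nil ∙ l)     c c′ o = ≤-trans (finish-runCarry-size₀ l ((nil ∙ nil) ∙ o)) (≤-reflexive
    (solve 2 (λ l o → con 4 :+ o :+ l := o :+ (con 2 :+ l :+ con 2)) refl (size l) (size o)))
  finish-runCarry-size₁ ((d ∙ e) ∙ l) c c′ o = ≤-trans (finish-runCarry-size₁ l nil nil (nil ∙ o)) (≤-trans (≤-reflexive
    (solve 2 (λ l o → con 2 :+ o :+ (l :+ con 2) := o :+ (con 2 :+ l :+ con 2)) refl (size l) (size o)))
    (+-monoʳ-≤ (size o) (s≤s (+-monoˡ-≤ 2 (+-monoˡ-≤ (size l) (s≤s {0} z≤n))))))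

  finish-run₀ : ∀ l o → finish (runCarry (nil ∙ o) l) ≡ revOntoᵗ o l
  finish-run₀ nil     o = refl
  finish-run₀ (d ∙ l) o = finish-run₀ l (d ∙ o)

  finish-run₁ : ∀ b o → finish (runCarry ((nil ∙ nil) ∙ o) (encodeℕᵇ b)) ≡ revOntoᵗ o (encodeℕᵇ (Binary.suc b))
  finish-run₁ Binary.zero o = refl
  finish-run₁ 2[1+ b ]    o = finish-run₁ b (nil ∙ o)
  finish-run₁ 1+[2 b ]    o = finish-run₀ (encodeℕᵇ b) ((nil ∙ nil) ∙ o)

  increment-size : ∀ l → size (finish (runCarry ((nil ∙ nil) ∙ nil) l)) ≤ size l + 3
  increment-size l = ≤-trans (finish-runCarry-size₁ l nil nil nil) (≤-reflexive (sym (+-suc (size l) 2)))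

binary : ∀ {n} → Term n → Term n
binary t = fold t nil nil (increment (var (# 1))) 3 λ v a →
  ≤-trans (increment-size a) (+-monoʳ-≤ (size a) (*-monoʳ-≤ 3 (size≥1 v)))

⇓-binary : ∀ {n} {t : Term n} {ρ a} → ρ ⊢ t ⇓ encodeUnary a → ρ ⊢ binary t ⇓ encodeBinary a
⇓-binary {a = a} (den p) = den (trans (cong (foldTree f nil) p) (trans (go a 0)
  (cong encodeℕᵇ (trans (cong Binary.fromℕ' (+-identityʳ a)) (sym (fromℕ≡fromℕ' a))))))
  where
  f : Tree → Tree → Tree
  f x a = ⟦ increment (var (# 1)) ⟧ (nil ∷ a ∷ [])
  go : ∀ a b → foldTree f (encodeℕᵇ (Binary.fromℕ' b)) (encodeUnary a) ≡ encodeℕᵇ (Binary.fromℕ' (a + b))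
  go zero    b = refl
  go (suc a) b = trans (cong (λ t → foldTree f t (encodeUnary a)) (finish-run₁ (Binary.fromℕ' b) nil))
                       (trans (go a (suc b)) (cong (λ m → encodeℕᵇ (Binary.fromℕ' m)) (+-suc a b)))

-- The family of 2-intervals

-- A 2-interval is described by the left endpoints of its two intervals.
Track : Set
Track = ℕ × ℕ

encodePair : ℕ × ℕ → Tree
encodePair (a , b) = encodeUnary a ∙ encodeUnary b

-- Vertices appear by rank. The diagonal of an adjacency matrix is `false`, so the pairs `(u , u)`
-- are included, and the gates also forbid two regions to choose the same vertex.
nonEdges : List (List Bool) → List (ℕ × ℕ)
nonEdges M = concatMap (λ (row , u) → concatMap (λ (b , v) → Bool.if b then [] else [ u , v ]) (ranked row)) (ranked M)

module Tracks (n : ℕ) where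

  -- The segments of a region cover only offsets from 0 to 4n.
  place : ℕ → ℕ → ℕ
  place i x = i * suc (4 * n) + x

  ladder : ℕ → ℕ → Track
  ladder i s = place i s , place i (s + suc (2 * n))

  gate : ℕ → ℕ → ℕ × ℕ → Track
  gate i j (u , v) = place i (u + suc n) , place j (v + suc n)

  ladders : ℕ → List Track
  ladders i = concatMap (λ s → [ ladder i s ]) (downFrom (suc n))

  gates : List (ℕ × ℕ) → ℕ → ℕ → List Track
  gates E i j = concatMap (λ e → [ gate i j e ]) E

  region : List (ℕ × ℕ) → ℕ → List Track
  region E i = ladders i ++ concatMap (gates E i) (downFrom i)

  tracks : List (ℕ × ℕ) → ℕ → List Track
  tracks E k = concatMap (region E) (downFrom k)

-- Deciding overlap, and programs for the family

near : ℕ → ℕ → ℕ → Bool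
near U a b = (a ≤ᵇ b + U) ∧ (b ≤ᵇ a + U)

overlaps : ℕ → Track → Track → Bool
overlaps U (a , b) (c , d) = (near U a c ∨ near U a d) ∨ (near U b c ∨ near U b d)

-- A loop knows a vertex only by its rank, so the diagonal is recognised by equal ranks; it is
-- `false` to keep the graph irreflexive.
cell : ℕ → Track → ℕ → Track → ℕ → Bool
cell U d r d′ r′ = Bool.if (r ≤ᵇ r′) ∧ (r′ ≤ᵇ r) then false else overlaps U d d′

nonEdgesᵗ : ∀ {n} → Term n → Term n
nonEdgesᵗ M = flat M (flat (hd (var (# 0)))
  (ifte (hd (var (# 0))) nil
        ((lengthᵗ (tl (var (# 1))) ∙ lengthᵗ (tl (var (# 0)))) ∙ nil)))

⇓-if : ∀ {n} {t u v : Term n} {ρ b} (f : Bool → Tree) →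
       ρ ⊢ t ⇓ encodeBool b → ρ ⊢ u ⇓ f true → ρ ⊢ v ⇓ f false → ρ ⊢ ifte t u v ⇓ f b
⇓-if {b = true}  f (den p) (den q) r = den (trans (cong (λ w → branch w _ _) p) q)
⇓-if {b = false} f (den p) q (den r) = den (trans (cong (λ w → branch w _ _) p) r)

⇓-nonEdges : ∀ {n} {t : Term n} {ρ M} → ρ ⊢ t ⇓ encodeList (encodeList encodeBool) M →
          ρ ⊢ nonEdgesᵗ t ⇓ encodeList encodePair (nonEdges M)
⇓-nonEdges p = ⇓-ranked p λ row M → ⇓-ranked (den refl) λ b bs →
  ⇓-if {b = b} (λ b → encodeList encodePair (Bool.if b then [] else [ length M , length bs ]))
    (den refl) (den refl)
    (⇓-single (⇓-cons (⇓-length (len-encodeList (encodeList encodeBool) M))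
                      (⇓-length (len-encodeList encodeBool bs))))

nearᵗ : ∀ {n} → Term n → Term n → Term n → Term n
nearᵗ U a b = and (le a (append b U)) (le b (append a U))

overlapsᵗ : ∀ {n} → Term n → Term n → Term n → Term n
overlapsᵗ U d e = or (or (nearᵗ U (hd d) (hd e)) (nearᵗ U (hd d) (tl e)))
                     (or (nearᵗ U (tl d) (hd e)) (nearᵗ U (tl d) (tl e)))

⇓-len : ∀ {n} {t : Term n} {ρ a} → ρ ⊢ t ⇓ encodeUnary a → len (⟦ t ⟧ ρ) ≡ a
⇓-len {a = a} (den p) = trans (cong len p) (len-encodeUnary a)

⇓-near : ∀ {m} {t u v : Term m} {ρ U a b} → ρ ⊢ t ⇓ encodeUnary U → ρ ⊢ u ⇓ encodeUnary a → ρ ⊢ v ⇓ encodeUnary b →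
         ρ ⊢ nearᵗ t u v ⇓ encodeBool (near U a b)
⇓-near p q r = ⇓-and (⇓-le (⇓-len q) (⇓-len (⇓-add r p))) (⇓-le (⇓-len r) (⇓-len (⇓-add q p)))

⇓-hd : ∀ {n} {t : Term n} {ρ v w} → ρ ⊢ t ⇓ v ∙ w → ρ ⊢ hd t ⇓ v
⇓-hd (den p) = den (cong head p)

⇓-tl : ∀ {n} {t : Term n} {ρ v w} → ρ ⊢ t ⇓ v ∙ w → ρ ⊢ tl t ⇓ w
⇓-tl (den p) = den (cong tail p)

⇓-overlaps : ∀ {m} {t u v : Term m} {ρ U d e} → ρ ⊢ t ⇓ encodeUnary U → ρ ⊢ u ⇓ encodePair d → ρ ⊢ v ⇓ encodePair e →
             ρ ⊢ overlapsᵗ t u v ⇓ encodeBool (overlaps U d e)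
⇓-overlaps p q r = ⇓-or (⇓-or (⇓-near p (⇓-hd q) (⇓-hd r)) (⇓-near p (⇓-hd q) (⇓-tl r)))
                        (⇓-or (⇓-near p (⇓-tl q) (⇓-hd r)) (⇓-near p (⇓-tl q) (⇓-tl r)))

cellᵗ : ∀ {n} → Term n → Term n → Term n → Term n
cellᵗ U ds es = ifte (and (le (tl ds) (tl es)) (le (tl es) (tl ds))) nil (overlapsᵗ U (hd ds) (hd es))

⇓-cell : ∀ {m} {t u v : Term m} {ρ U d r ds e s es} → ρ ⊢ t ⇓ encodeUnary U →
         ρ ⊢ u ⇓ encodePair d ∙ ds → len ds ≡ r → ρ ⊢ v ⇓ encodePair e ∙ es → len es ≡ s →
         ρ ⊢ cellᵗ t u v ⇓ encodeBool (cell U d r e s)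
⇓-cell {U = U} {d} {e = e} p q r s t =
  ⇓-if (λ b → encodeBool (Bool.if b then false else overlaps U d e))
    (⇓-and (⇓-le (trans (cong len (value (⇓-tl q))) r) (trans (cong len (value (⇓-tl s))) t))
           (⇓-le (trans (cong len (value (⇓-tl s))) t) (trans (cong len (value (⇓-tl q))) r)))
    (den refl) (⇓-overlaps p (⇓-hd q) (⇓-hd s))

-- Concatenating one copy of the width for every cell of `i` is unary multiplication; `suc W` skips
-- the variable bound by this loop.
placeᵗ : ∀ {n} → Fin n → Term n → Term n → Term n
placeᵗ W i t = append (flat i (var (suc W))) t

-- The inner `nil` mirrors the unfolding of `2 * a` to `a + (a + 0)`.
twice : ∀ {n} → Term n → Term n
twice t = append t (append t nil)

⇓-twice : ∀ {n} {t : Term n} {ρ a} → ρ ⊢ t ⇓ encodeUnary a → ρ ⊢ twice t ⇓ encodeUnary (2 * a)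
⇓-twice p = ⇓-add p (⇓-add p (den refl))

⇓-suc : ∀ {n} {t : Term n} {ρ a} → ρ ⊢ t ⇓ encodeUnary a → ρ ⊢ nil ∙ t ⇓ encodeUnary (suc a)
⇓-suc = ⇓-cons (den refl)

-- W, E and n are the variables that hold the width of a region, the
-- non-adjacent pairs and the number of vertices.  The variables bound by the
-- loops over i, j and s hold the unary numbers i + 1, j + 1 and s + 1.
tracksᵗ : ∀ {n} → Term n → Fin n → Fin n → Fin n → Term n
tracksᵗ k W E n = flat k (append
  (flat (nil ∙ var (suc n))
     ((placeᵗ (suc (suc W)) (tl (var (# 1))) (tl (var (# 0))) ∙
       placeᵗ (suc (suc W)) (tl (var (# 1))) (append (tl (var (# 0))) (nil ∙ twice (var (suc (suc n)))))) ∙ nil))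
  (flat (tl (var (# 0))) (flat (var (suc (suc E)))
     ((placeᵗ (suc (suc (suc W))) (tl (var (# 2))) (append (hd (hd (var (# 0)))) (nil ∙ var (suc (suc (suc n))))) ∙
       placeᵗ (suc (suc (suc W))) (tl (var (# 1))) (append (tl (hd (var (# 0)))) (nil ∙ var (suc (suc (suc n)))))) ∙ nil))))

module _ (n : ℕ) where
  open Tracks n

  ⇓-place : ∀ {m} {w : Fin m} {t u : Term m} {ρ i x} → ρ ⊢ var w ⇓ encodeUnary (suc (4 * n)) →
            ρ ⊢ t ⇓ encodeUnary i → ρ ⊢ u ⇓ encodeUnary x → ρ ⊢ placeᵗ w t u ⇓ encodeUnary (place i x)
  ⇓-place p q r = ⇓-add (⇓-mul q (λ _ → den (value p))) r

  ⇓-tracks : ∀ {m} {t : Term m} {w e v ρ k E} → ρ ⊢ t ⇓ encodeUnary k →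
    ρ ⊢ var w ⇓ encodeUnary (suc (4 * n)) → ρ ⊢ var e ⇓ encodeList encodePair E → ρ ⊢ var v ⇓ encodeUnary n →
    ρ ⊢ tracksᵗ t w e v ⇓ encodeList encodePair (tracks E k)
  ⇓-tracks p (den W⇓) (den E⇓) (den n⇓) = ⇓-downFrom p λ i → ⇓-append
    (⇓-downFrom {g = λ s → [ ladder i s ]} (⇓-suc (den n⇓)) λ s → ⇓-single (⇓-cons
      (⇓-place (den W⇓) (den refl) (den refl))
      (⇓-place (den W⇓) (den refl) (⇓-add {b = suc (2 * n)} (den refl) (⇓-suc (⇓-twice (den n⇓)))))))
    (⇓-downFrom (den refl) λ j → ⇓-concatMap {g = λ e → [ gate i j e ]} (den E⇓) λ e es → ⇓-single (⇓-cons
      (⇓-place (den W⇓) (den refl) (⇓-add (den refl) (⇓-suc (den n⇓))))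
      (⇓-place (den W⇓) (den refl) (⇓-add (den refl) (⇓-suc (den n⇓))))))

-- Unit 2-interval graphs from integer starts

Near : ℕ → ℕ → ℕ → Set
Near U a b = a ≤ b + U × b ≤ a + U

Near-refl : ∀ {U} a → Near U a a
Near-refl {U} a = m≤m+n a U , m≤m+n a U

infix 4 _∈ᵗ_

_∈ᵗ_ : ℕ → Track → Set
x ∈ᵗ (a , b) = x ≡ a ⊎ x ≡ b

Overlap : ℕ → Track → Track → Set
Overlap U d e = ∃[ x ] ∃[ y ] (x ∈ᵗ d × y ∈ᵗ e × Near U x y)

near⇔Near : ∀ {U a b} → T (near U a b) ⇔ Near U a b
near⇔Near {U} {a} {b} = mk⇔
  (λ t → let p , q = Equivalence.to T-∧ t in ≤ᵇ⇒≤ a (b + U) p , ≤ᵇ⇒≤ b (a + U) q)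
  (λ (p , q) → Equivalence.from T-∧ (≤⇒≤ᵇ p , ≤⇒≤ᵇ q))

overlaps⇔Overlap : ∀ {U d e} → T (overlaps U d e) ⇔ Overlap U d e
overlaps⇔Overlap {U} {a , b} {c , d} = mk⇔
  (λ t → [ (λ t → [ from (inj₁ refl) (inj₁ refl) , from (inj₁ refl) (inj₂ refl) ]′ (Equivalence.to T-∨ t))
         , (λ t → [ from (inj₂ refl) (inj₁ refl) , from (inj₂ refl) (inj₂ refl) ]′ (Equivalence.to T-∨ t)) ]′
         (Equivalence.to T-∨ t))
  λ where
    (_ , _ , inj₁ refl , inj₁ refl , p) → left  (left  (to p))
    (_ , _ , inj₁ refl , inj₂ refl , p) → left  (right (near U a c) (to p))
    (_ , _ , inj₂ refl , inj₁ refl , p) → right (near U a c ∨ near U a d) (left  (to p))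
    (_ , _ , inj₂ refl , inj₂ refl , p) → right (near U a c ∨ near U a d) (right (near U b c) (to p))
  where
  left : ∀ {s t} → T s → T (s ∨ t)
  left p = Equivalence.from T-∨ (inj₁ p)
  right : ∀ s {t} → T t → T (s ∨ t)
  right s p = Equivalence.from (T-∨ {s}) (inj₂ p)
  to : ∀ {x y} → Near U x y → T (near U x y)
  to = Equivalence.from near⇔Near
  from : ∀ {x y} → x ∈ᵗ (a , b) → y ∈ᵗ (c , d) → T (near U x y) → Overlap U (a , b) (c , d)
  from p q t = _ , _ , p , q , Equivalence.to near⇔Near t

-- Starts are integers and the unit of length is U + ½, so that after scaling
-- two intervals meet iff their starts differ by at most U, even for U = 0.
scaled : ℕ → ℕ → ℚᵘ
scaled U m = mkℚᵘ (pos m) (2 * U)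

scaled-mono : ∀ U {m n} → m ≤ n → scaled U m ℚᵘ.≤ scaled U n
scaled-mono U m≤n = *≤* (ℤₚ.*-monoʳ-≤-nonNeg (pos (suc (2 * U))) (ℤ.+≤+ m≤n))

scaled-cancel : ∀ U {m n} → scaled U m ℚᵘ.≤ scaled U n → m ≤ n
scaled-cancel U (*≤* p) = ℤₚ.drop‿+≤+ (ℤₚ.*-cancelʳ-≤-pos _ _ (pos (suc (2 * U))) p)

segment : ℕ → ℕ → Interval
segment U a = record
  { left    = scaled U (2 * a)
  ; right   = scaled U (2 * a + suc (2 * U))
  ; ordered = scaled-mono U (m≤m+n (2 * a) (suc (2 * U)))
  }

segment-unit : ∀ U a → HasUnitLength (segment U a)
segment-unit U a = *≡* (begin
  (pos (x + d) ℤ.* pos d ℤ.+ ℤ.- pos x ℤ.* pos d) ℤ.* pos 1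
    ≡⟨ cong (λ y → (y ℤ.* pos d ℤ.+ ℤ.- pos x ℤ.* pos d) ℤ.* pos 1) (ℤₚ.pos-+ x d) ⟩
  ((pos x ℤ.+ pos d) ℤ.* pos d ℤ.+ ℤ.- pos x ℤ.* pos d) ℤ.* pos 1
    ≡⟨ ring (pos x) (pos d) ⟩
  pos 1 ℤ.* (pos d ℤ.* pos d)
    ∎)
  where
  open ≡-Reasoning
  x = 2 * a
  d = suc (2 * U)
  ring : ∀ x d → ((x ℤ.+ d) ℤ.* d ℤ.+ ℤ.- x ℤ.* d) ℤ.* pos 1 ≡ pos 1 ℤ.* (d ℤ.* d)
  ring = ℤSolver.solve-∀

reach : ∀ U {a b} → a ≤ b + U → scaled U (2 * a) ℚᵘ.≤ scaled U (2 * b + suc (2 * U))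
reach U {a} {b} a≤b+U = scaled-mono U (begin
  2 * a                ≤⟨ *-monoʳ-≤ 2 a≤b+U ⟩
  2 * (b + U)          ≡⟨ *-distribˡ-+ 2 b U ⟩
  2 * b + 2 * U        ≤⟨ +-monoʳ-≤ (2 * b) (n≤1+n (2 * U)) ⟩
  2 * b + suc (2 * U)  ∎)
  where open ≤-Reasoning

-- Before scaling, left ends are even and right ends odd, so a start beyond `b + U` lies strictly
-- beyond the right end of the segment of `b`.
reach⁻¹ : ∀ U {a b} → scaled U (2 * a) ℚᵘ.≤ scaled U (2 * b + suc (2 * U)) → a ≤ b + U
reach⁻¹ U {a} {b} p = ≮⇒≥ λ b+U<a → <⇒≱ (begin-strict
  2 * b + suc (2 * U)  <⟨ ≤-reflexive (identity b U) ⟩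
  2 * suc (b + U)      ≤⟨ *-monoʳ-≤ 2 b+U<a ⟩
  2 * a                ∎) (scaled-cancel U p)
  where
  open ≤-Reasoning
  identity : ∀ b U → suc (2 * b + suc (2 * U)) ≡ 2 * suc (b + U)
  identity = solve 2 (λ b U → con 1 :+ (con 2 :* b :+ (con 1 :+ con 2 :* U)) := con 2 :* (con 1 :+ (b :+ U))) refl

segments-meet : ∀ {U a b} → (∃[ x ] (x ∈ᴵ segment U a × x ∈ᴵ segment U b)) ⇔ Near U a b
segments-meet {U} {a} {b} = mk⇔
  (λ (x , (p , q) , (r , s)) → reach⁻¹ U {a} {b} (ℚᵘₚ.≤-trans p s) , reach⁻¹ U {b} {a} (ℚᵘₚ.≤-trans r q))
  λ (p , q) →
    -- The later of the two left ends is a common point.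
    [ (λ a≤b → scaled U (2 * b) , (scaled-mono U (*-monoʳ-≤ 2 a≤b) , reach U {b} {a} q) ,
                                  (ℚᵘₚ.≤-refl , Interval.ordered (segment U b)))
    , (λ b≤a → scaled U (2 * a) , (ℚᵘₚ.≤-refl , Interval.ordered (segment U a)) ,
                                  (scaled-mono U (*-monoʳ-≤ 2 b≤a) , reach U {a} {b} p)) ]′
    (≤-total a b)

twoSegments : ∀ U (d : Track) → ¬ Near U (proj₁ d) (proj₂ d) → TwoInterval
twoSegments U (a , b) apart = record
  { first = segment U a; second = segment U b; disjoint = λ p → apart (Equivalence.to segments-meet p) }

Intersect⇔Overlap : ∀ {U d e p q} → Intersect (twoSegments U d p) (twoSegments U e q) ⇔ Overlap U d e
Intersect⇔Overlap {U} {a , b} {c , d} = mk⇔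
  (λ where
    (x , inj₁ p , inj₁ q) → _ , _ , inj₁ refl , inj₁ refl , Equivalence.to segments-meet (x , p , q)
    (x , inj₁ p , inj₂ q) → _ , _ , inj₁ refl , inj₂ refl , Equivalence.to segments-meet (x , p , q)
    (x , inj₂ p , inj₁ q) → _ , _ , inj₂ refl , inj₁ refl , Equivalence.to segments-meet (x , p , q)
    (x , inj₂ p , inj₂ q) → _ , _ , inj₂ refl , inj₂ refl , Equivalence.to segments-meet (x , p , q))
  λ where
    (_ , _ , inj₁ refl , inj₁ refl , r) → let x , p , q = Equivalence.from segments-meet r in x , inj₁ p , inj₁ q
    (_ , _ , inj₁ refl , inj₂ refl , r) → let x , p , q = Equivalence.from segments-meet r in x , inj₁ p , inj₂ q
    (_ , _ , inj₂ refl , inj₁ refl , r) → let x , p , q = Equivalence.from segments-meet r in x , inj₂ p , inj₁ q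
    (_ , _ , inj₂ refl , inj₂ refl , r) → let x , p , q = Equivalence.from segments-meet r in x , inj₂ p , inj₂ q

T-≡ : ∀ {b c} → (T b → T c) → (T c → T b) → b ≡ c
T-≡ {true}  {true}  f g = refl
T-≡ {false} {false} f g = refl
T-≡ {true}  {false} f g = ⊥-elim (f _)
T-≡ {false} {true}  f g = ⊥-elim (g _)

Overlap-sym : ∀ {U d e} → Overlap U d e → Overlap U e d
Overlap-sym (x , y , p , q , r , s) = y , x , q , p , s , r

rank-injective : ∀ {n} {u v : Fin n} → rank u ≡ rank v → u ≡ v
rank-injective {u = u} {v} eq = trans (sym (opposite-involutive u))
  (trans (cong opposite (toℕ-injective eq)) (opposite-involutive v))

module Target (U : ℕ) (D : List Track) (apart : ∀ {d} → d ∈ D → ¬ Near U (proj₁ d) (proj₂ d)) where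

  adjacent : Fin (length D) → Fin (length D) → Bool
  adjacent u v = cell U (lookup D u) (rank u) (lookup D v) (rank v)

  adjacent⇔Overlap : ∀ {u v} → T (adjacent u v) ⇔ (u ≢ v × Overlap U (lookup D u) (lookup D v))
  adjacent⇔Overlap {u} {v} with (rank u ≤ᵇ rank v) ∧ (rank v ≤ᵇ rank u) in eq
  ... | true  = mk⇔ (λ ()) λ (u≢v , _) → u≢v (rank-injective
    (let p , q = Equivalence.to T-∧ (subst T (sym eq) _) in ≤-antisym (≤ᵇ⇒≤ _ _ p) (≤ᵇ⇒≤ _ _ q)))
  ... | false = mk⇔
    (λ t → (λ { refl → subst T eq (Equivalence.from T-∧ (≤⇒≤ᵇ (≤-refl {rank u}) , ≤⇒≤ᵇ (≤-refl {rank u}))) })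
         , Equivalence.to overlaps⇔Overlap t)
    λ (_ , p) → Equivalence.from overlaps⇔Overlap p

  graph : Graph (length D)
  graph = record
    { adjacent    = adjacent
    ; symmetric   = λ u v → T-≡ flipped flipped
    ; irreflexive = λ v → T-≡ (λ t → proj₁ (Equivalence.to adjacent⇔Overlap t) refl) λ ()
    }
    where
    flipped : ∀ {u v} → T (adjacent u v) → T (adjacent v u)
    flipped t = let u≢v , p = Equivalence.to adjacent⇔Overlap t
                in Equivalence.from adjacent⇔Overlap (≢-sym u≢v , Overlap-sym p)

  interval : Fin (length D) → TwoInterval
  interval v = twoSegments U (lookup D v) (apart (∈-lookup v))

  interval⇔ : ∀ u v → Intersect (interval u) (interval v) ⇔ Overlap U (lookup D u) (lookup D v)
  interval⇔ u v = Intersect⇔Overlap {U} {lookup D u} {lookup D v} {apart (∈-lookup u)} {apart (∈-lookup v)}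

  representation : UnitTwoIntervalRepresentation graph
  representation = record
    { interval   = interval
    ; unit       = λ v → segment-unit U (proj₁ (lookup D v)) , segment-unit U (proj₂ (lookup D v))
    ; represents = λ {u} {v} u≢v → mk⇔
        (λ t → Equivalence.from (interval⇔ u v) (proj₂ (Equivalence.to adjacent⇔Overlap t)))
        (λ p → Equivalence.from adjacent⇔Overlap (u≢v , Equivalence.to (interval⇔ u v) p))
    }

-- Membership in the lists of pairs and 2-intervals

∈-concatMap-tabulate : ∀ {A B : Set} {n} {f : A → List B} {g : Fin n → A} {y} →
  y ∈ concatMap f (tabulate g) ⇔ (∃[ i ] y ∈ f (g i))
∈-concatMap-tabulate {f = f} = mk⇔ (λ p → tabulate⁻ (∈-concatMap⁻ f p))
  (λ (i , p) → ∈-concatMap⁺ f (tabulate⁺ i p))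

∈-concatMap-downFrom : ∀ {B : Set} k (f : ℕ → List B) {y} →
  y ∈ concatMap f (downFrom k) ⇔ (∃[ i ] (i < k × y ∈ f i))
∈-concatMap-downFrom k f = mk⇔
  (λ p → let i , q , r = find (∈-concatMap⁻ f p) in i , ∈-downFrom⁻ q , r)
  (λ (i , i<k , p) → ∈-concatMap⁺ f (lose (∈-downFrom⁺ i<k) p))

rows : ∀ {n} → Graph n → List (List Bool)
rows G = tabulate λ u → tabulate λ v → Graph.adjacent G u v

∈-nonEdges : ∀ {n} (G : Graph n) {e} → e ∈ nonEdges (rows G) ⇔
             (∃[ u ] ∃[ v ] (Graph.adjacent G u v ≡ false × e ≡ (rank u , rank v)))
∈-nonEdges {n} G = mk⇔ to from
  where
  adj = Graph.adjacent G

  select : ℕ → Bool × ℕ → List (ℕ × ℕ)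
  select x (b , y) = Bool.if b then [] else [ x , y ]

  selectRow : List Bool × ℕ → List (ℕ × ℕ)
  selectRow (row , x) = concatMap (select x) (ranked row)

  to : ∀ {e} → e ∈ nonEdges (rows G) → ∃[ u ] ∃[ v ] (adj u v ≡ false × e ≡ (rank u , rank v))
  to p with Equivalence.to (∈-concatMap-tabulate {f = selectRow})
              (subst (λ l → _ ∈ concatMap selectRow l) (ranked-tabulate (tabulate ∘ adj)) p)
  ... | u , q with Equivalence.to (∈-concatMap-tabulate {f = select (rank u)})
                     (subst (λ l → _ ∈ concatMap (select (rank u)) l) (ranked-tabulate (adj u)) q)
  ...   | v , r with adj u v in eq
  to p | u , q | v , here e≡ | false = u , v , eq , e≡

  from : ∀ {e} → ∃[ u ] ∃[ v ] (adj u v ≡ false × e ≡ (rank u , rank v)) → e ∈ nonEdges (rows G)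
  from (u , v , eq , refl) =
    subst (λ l → _ ∈ concatMap selectRow l) (sym (ranked-tabulate (tabulate ∘ adj)))
      (Equivalence.from (∈-concatMap-tabulate {f = selectRow}) (u ,
        subst (λ l → _ ∈ concatMap (select (rank u)) l) (sym (ranked-tabulate (adj u)))
          (Equivalence.from (∈-concatMap-tabulate {f = select (rank u)}) (v ,
            subst (λ b → _ ∈ select (rank u) (b , rank v)) (sym eq) (here refl)))))

-- Rungs, gates and the separation of regions

data Kind (n : ℕ) (E : List (ℕ × ℕ)) (k : ℕ) : Track → Set where
  ladder : ∀ {i s} → i < k → s < suc n → Kind n E k (Tracks.ladder n i s)
  gate   : ∀ {i j e} → i < k → j < i → e ∈ E → Kind n E k (Tracks.gate n i j e)

module _ (n : ℕ) (E : List (ℕ × ℕ)) (k : ℕ) where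
  private
    module Tₙ = Tracks n

  kind : ∀ {d} → d ∈ Tₙ.tracks E k → Kind n E k d
  kind p with Equivalence.to (∈-concatMap-downFrom k (Tₙ.region E)) p
  ... | i , i<k , q with ∈-++⁻ (Tₙ.ladders i) q
  ... | inj₁ r with Equivalence.to (∈-concatMap-downFrom (suc n) (λ s → [ Tₙ.ladder i s ])) r
  ...   | s , s≤n , here refl = ladder i<k s≤n
  kind p | i , i<k , q | inj₂ r with Equivalence.to (∈-concatMap-downFrom i (Tₙ.gates E i)) r
  ...   | j , j<i , q′ with find (∈-concatMap⁻ (λ e → [ Tₙ.gate i j e ]) {xs = E} q′)
  ...     | e , e∈E , here refl = gate i<k j<i e∈E

  kind⁻¹ : ∀ {d} → Kind n E k d → d ∈ Tₙ.tracks E k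
  kind⁻¹ (ladder {i} {s} i<k s≤n) = Equivalence.from (∈-concatMap-downFrom k (Tₙ.region E)) (i , i<k ,
    ∈-++⁺ˡ (Equivalence.from (∈-concatMap-downFrom (suc n) (λ s → [ Tₙ.ladder i s ])) (s , s≤n , here refl)))
  kind⁻¹ (gate {i} {j} i<k j<i e∈E) = Equivalence.from (∈-concatMap-downFrom k (Tₙ.region E)) (i , i<k ,
    ∈-++⁺ʳ (Tₙ.ladders i) (Equivalence.from (∈-concatMap-downFrom i (Tₙ.gates E i)) (j , j<i ,
      ∈-concatMap⁺ (λ e → [ Tₙ.gate i j e ]) (lose e∈E (here refl)))))

-- With `n = suc m`, an offset of at most `3 * n + 1` plus the reach `m` stays just below the width
-- `4 * n + 1`, so that different regions never interact.
width-identity : ∀ m → suc (suc (3 * suc m) + m) ≡ suc (4 * suc m)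
width-identity = solve 1 (λ m → con 2 :+ con 3 :* (con 1 :+ m) :+ m := con 1 :+ con 4 :* (con 1 :+ m)) refl

module _ (m : ℕ) where
  open Tracks (suc m) using (place)
  private
    W R : ℕ
    W = suc (4 * suc m)
    R = suc (3 * suc m)

    far : ∀ {i j x y} → x ≤ R → i < j → ¬ (place j y ≤ place i x + m)
    far {i} {j} {x} {y} x≤R i<j p = <⇒≱ (begin-strict
      i * W + x + m      ≡⟨ +-assoc (i * W) x m ⟩
      i * W + (x + m)    <⟨ +-monoʳ-< (i * W) (≤-<-trans (+-monoˡ-≤ m x≤R) (≤-reflexive (width-identity m))) ⟩
      i * W + W          ≡⟨ +-comm (i * W) W ⟩
      suc i * W          ≤⟨ *-monoˡ-≤ W i<j ⟩
      j * W              ≤⟨ m≤m+n (j * W) y ⟩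
      j * W + y          ∎) p
      where open ≤-Reasoning

  near-place : ∀ {i j x y} → x ≤ R → y ≤ R → Near m (place i x) (place j y) → i ≡ j × Near m x y
  near-place {i} {j} {x} {y} x≤R y≤R (p , q) with <-cmp i j
  ... | tri< i<j _ _  = contradiction q (far {i} {j} {x} x≤R i<j)
  ... | tri> _ _ j<i  = contradiction p (far {j} {i} {y} y≤R j<i)
  ... | tri≈ _ refl _ = refl , cancel p , cancel q
    where
    cancel : ∀ {x y} → place i x ≤ place i y + m → x ≤ y + m
    cancel {x} {y} p = +-cancelˡ-≤ (i * W) x (y + m) (≤-trans p (≤-reflexive (+-assoc (i * W) y m)))

gate-range : ∀ {n u} → u ≤ n → u + suc n ≤ suc (3 * n)
gate-range {n} {u} u≤n = begin
  u + suc n         ≤⟨ +-monoˡ-≤ (suc n) u≤n ⟩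
  n + suc n         ≡⟨ +-suc n n ⟩
  suc (n + n)       ≤⟨ s≤s (+-monoʳ-≤ n (m≤m+n n (n + 0))) ⟩
  suc (3 * n)       ∎
  where open ≤-Reasoning

ladder-range : ∀ {n s} → s ≤ n → s + suc (2 * n) ≤ suc (3 * n)
ladder-range {n} {s} s≤n = ≤-trans (+-monoˡ-≤ (suc (2 * n)) s≤n) (≤-reflexive (+-suc n (2 * n)))

ladder-range₀ : ∀ {n s} → s ≤ n → s ≤ suc (3 * n)
ladder-range₀ s≤n = ≤-trans (m≤m+n _ _) (ladder-range s≤n)

rank<n : ∀ {n} (u : Fin n) → rank u < n
rank<n u = toℕ<n (opposite u)

module _ {n} (G : Graph n) (k : ℕ) where

  trackList : List Track
  trackList = Tracks.tracks n (nonEdges (rows G)) k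

  -- The starts of a rung differ by `2 * n + 1`, which exceeds `pred n`; those of a gate lie in
  -- different regions because `j < i`.
  apart : ∀ {d} → d ∈ trackList → ¬ Near (pred n) (proj₁ d) (proj₂ d)
  apart p near with kind n (nonEdges (rows G)) k p
  ... | ladder {i} {s} _ _ = <⇒≱ (s≤s (≤-trans (pred[n]≤n {n}) (m≤m+n n (n + 0))))
    (+-cancelˡ-≤ (i * W + s) (suc (2 * n)) (pred n) (≤-trans (≤-reflexive (+-assoc (i * W) s _)) (proj₂ near)))
    where W = suc (4 * n)
  ... | gate _ j<i e∈E with Equivalence.to (∈-nonEdges G) e∈E
  -- The existence of u makes n positive.
  apart p near | gate _ j<i e∈E | u@zero , v , _ , refl =
    <⇒≢ j<i (sym (proj₁ (near-place _ (gate-range (<⇒≤ (rank<n u))) (gate-range (<⇒≤ (rank<n v))) near)))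
  apart p near | gate _ j<i e∈E | u@(suc _) , v , _ , refl =
    <⇒≢ j<i (sym (proj₁ (near-place _ (gate-range (<⇒≤ (rank<n u))) (gate-range (<⇒≤ (rank<n v))) near)))

-- The reduction and its program

-- If n = 0, then the two end rungs coincide and 2k parts would always do.
parts : ℕ → ℕ → ℕ
parts zero    k = 0
parts (suc _) k = 2 * k

reduce : CliqueInstance → UnitTwoIntervalInstance
reduce x = record
  { graph          = Target.graph (pred n) (trackList graph k) (apart graph k)
  ; representation = Target.representation (pred n) (trackList graph k) (apart graph k)
  ; k              = parts n k
  }
  where open CliqueInstance x

-- The `nil` before each numerator is the sign of a non-negative integer; both denominators are
-- `2 * U + 1`.
segmentᵗ : ∀ {n} → Term n → Term n → Term n
segmentᵗ U a = ((nil ∙ binary (twice a)) ∙ binary (nil ∙ twice U)) ∙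
               ((nil ∙ binary (append (twice a) (nil ∙ twice U))) ∙ binary (nil ∙ twice U))

⇓-segment : ∀ {m} {t u : Term m} {ρ U a} → ρ ⊢ t ⇓ encodeUnary U → ρ ⊢ u ⇓ encodeUnary a →
            ρ ⊢ segmentᵗ t u ⇓ encodeInterval (segment U a)
⇓-segment p q = ⇓-cons (⇓-cons (⇓-cons (den refl) (⇓-binary (⇓-twice q))) d)
                       (⇓-cons (⇓-cons (den refl) (⇓-binary (⇓-add (⇓-twice q) (⇓-suc (⇓-twice p))))) d)
  where d = ⇓-binary (⇓-suc (⇓-twice p))

-- The encoded adjacency matrix is `nil` exactly for the graph without vertices.
partsᵗ : ∀ {n} → Term n → Term n
partsᵗ x = ifte (hd x) (twice (tl x)) nil

⇓-parts : ∀ {m n k} {t : Term m} {ρ} (G : Graph n) → ρ ⊢ t ⇓ encodeGraph G ∙ encodeUnary k →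
          ρ ⊢ partsᵗ t ⇓ encodeUnary (parts n k)
⇓-parts {n = zero}  {t = t} {ρ} G (den p) = den (cong (λ x → branch (head x) (⟦ twice (tl t) ⟧ ρ) nil) p)
⇓-parts {n = suc _} {k} {t} {ρ} G p =
  den (trans (cong (λ x → branch (head x) (⟦ twice (tl t) ⟧ ρ) nil) (value p)) (value (⇓-twice {a = k} (⇓-tl p))))

⇓-pred : ∀ {n} {t : Term n} {ρ a} → ρ ⊢ t ⇓ encodeUnary a → ρ ⊢ tl t ⇓ encodeUnary (pred a)
⇓-pred {a = zero}  (den p) = den (cong tail p)
⇓-pred {a = suc a} (den p) = den (cong tail p)

-- Below the last binder the variables 0 to 4 hold the 2-intervals, the width of
-- a region, the non-adjacent pairs, n and the input.
abstract
  reductionᵗ : Term 1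
  reductionᵗ =
    let-in (lengthᵗ (hd (var (# 0))))
    (let-in (nonEdgesᵗ (hd (var (# 1))))
    (let-in (nil ∙ append n (append n (append n (append n nil))))
    (let-in (tracksᵗ (tl (var (# 3))) (# 0) (# 1) (# 2))
    (matrixᵗ ∙ (representationᵗ ∙ partsᵗ (var (# 4)))))))
    where
    n : Term 3
    n = var (# 1)
    matrixᵗ representationᵗ : Term 5
    matrixᵗ         = flat (var (# 0)) (flat (var (# 1))
                        (cellᵗ (tl (var (# 5))) (var (# 1)) (var (# 0)) ∙ nil) ∙ nil)
    representationᵗ = flat (var (# 0))
                        ((segmentᵗ (tl (var (# 4))) (hd (hd (var (# 0)))) ∙
                          segmentᵗ (tl (var (# 4))) (tl (hd (var (# 0))))) ∙ nil)

  ⇓-reduction : ∀ x → (ParameterizedProblem.encode k-Clique x ∷ []) ⊢ reductionᵗ ⇓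
                ParameterizedProblem.encode k-VertexCliquePartition-unit2Interval (reduce x)
  ⇓-reduction record { n = n ; graph = G ; k = k } =
    ⇓-let-in (⇓-length (trans (len-encodeList (encodeList encodeBool) (rows G)) (length-tabulate _)))
    (⇓-let-in (⇓-nonEdges {M = rows G} (den refl))
    (⇓-let-in (⇓-suc (⇓-add (den refl) (⇓-add (den refl) (⇓-add (den refl) (⇓-add {b = 0} (den refl) (den refl))))))
    (⇓-let-in (⇓-tracks n (den refl) (den refl) (den refl) (den refl))
    (⇓-cons
      (⇓-tabulate (λ d r → encodeList encodeBool (tabulate λ v → cell (pred n) d r (lookup D v) (rank v)))
        (den D≡) (λ d ds → ⇓-single
          (⇓-tabulate (λ e s → encodeBool (cell (pred n) d (length ds) e s)) (den D≡)
            (λ e es → ⇓-single (⇓-cell (⇓-pred (den refl)) (den refl) (len-encodeList encodePair ds)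
                                                           (den refl) (len-encodeList encodePair es)))
            (λ _ → refl)))
        (λ _ → refl))
      (⇓-cons
        (⇓-tabulate (λ d _ → encodeInterval (segment (pred n) (proj₁ d)) ∙ encodeInterval (segment (pred n) (proj₂ d)))
          (den D≡) (λ d ds → ⇓-single (⇓-cons (⇓-segment (⇓-pred (den refl)) (den refl))
                                              (⇓-segment (⇓-pred (den refl)) (den refl))))
          (λ _ → refl))
        (⇓-parts G (den refl)))))))
    where
    D : List Track
    D = trackList G k
    D≡ : encodeList encodePair D ≡ encodeList encodePair (tabulate (lookup D))
    D≡ = cong (encodeList encodePair) (sym (tabulate-lookup D))

-- Cliques and clique partitions

PairwiseAdjacent : ∀ {n k} → Graph n → (Fin k → Fin n) → Set
PairwiseAdjacent G f = ∀ {i j} → i ≢ j → Adjacent G (f i) (f j)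

enumerate : ∀ {n} (S : Subset n) →
  Σ[ f ∈ (Fin ∣ S ∣ → Fin n) ] (Injective _≡_ _≡_ f × (∀ i → f i Subset.∈ S))
enumerate [] = (λ ()) , (λ {}) , λ ()
enumerate (outside ∷ S) =
  let f , inj , f∈S = enumerate S
  in suc ∘ f , (λ eq → inj (sucᶠ-injective eq)) , λ i → there (f∈S i)
enumerate (inside ∷ S) with enumerate S
... | f , inj , f∈S = g , g-inj , g∈S
  where
  g : Fin (suc ∣ S ∣) → Fin _
  g zero    = zero
  g (suc i) = suc (f i)
  g-inj : Injective _≡_ _≡_ g
  g-inj {zero}  {zero}  eq = refl
  g-inj {suc i} {suc j} eq = cong suc (inj (sucᶠ-injective eq))
  g∈S : ∀ i → g i Subset.∈ inside ∷ S
  g∈S zero    = here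
  g∈S (suc i) = there (f∈S i)

insert : ∀ {n} (S : Subset n) (x : Fin n) → ¬ (x Subset.∈ S) →
  Σ[ S′ ∈ Subset n ] (∣ S′ ∣ ≡ suc ∣ S ∣ × (∀ {y} → y Subset.∈ S′ → y ≡ x ⊎ y Subset.∈ S))
insert (inside  ∷ S) zero    x∉S = contradiction here x∉S
insert (outside ∷ S) zero    x∉S = inside ∷ S , refl , λ { here → inj₁ refl ; (there p) → inj₂ (there p) }
insert (b ∷ S)       (suc x) x∉S with insert S x (x∉S ∘ there)
insert (inside  ∷ S) (suc x) x∉S | S′ , eq , p = inside ∷ S′ , cong suc eq , λ where
  here      → inj₂ here
  (there q) → [ inj₁ ∘ cong suc , inj₂ ∘ there ]′ (p q)
insert (outside ∷ S) (suc x) x∉S | S′ , eq , p = outside ∷ S′ , eq , λ where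
  (there q) → [ inj₁ ∘ cong suc , inj₂ ∘ there ]′ (p q)

image : ∀ {n k} (f : Fin k → Fin n) → Injective _≡_ _≡_ f →
  Σ[ S ∈ Subset n ] (∣ S ∣ ≡ k × (∀ {y} → y Subset.∈ S → ∃[ i ] f i ≡ y))
image {n} {zero}  f inj = Subset.⊥ , ∣⊥∣≡0 n , λ p → contradiction p ∉⊥
image {n} {suc k} f inj with image (f ∘ suc) (λ eq → sucᶠ-injective (inj eq))
... | S , eq , p with insert S (f zero) (λ f0∈S → let i , q = p f0∈S in contradiction (inj q) λ ())
... | S′ , eq′ , p′ = S′ , trans eq′ (cong suc eq) , λ q →
  [ (λ y≡ → zero , sym y≡) , (λ r → let i , s = p r in suc i , s) ]′ (p′ q)

-- By irreflexivity a pairwise adjacent family has no repetitions, so its image has exactly `k`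
-- elements; conversely the elements of a clique are listed.
HasClique⇔PairwiseAdjacent : ∀ {n k} (G : Graph n) →
  HasClique G k ⇔ (Σ[ f ∈ (Fin k → Fin n) ] PairwiseAdjacent G f)
HasClique⇔PairwiseAdjacent G = mk⇔
  (λ { (S , refl , clique) → let f , inj , f∈S = enumerate S
                             in f , λ i≢j → clique (f∈S _) (f∈S _) (i≢j ∘ inj) })
  (λ (f , adj) →
    let S , eq , p = image f (inj f adj)
    in S , eq , λ u∈S v∈S u≢v →
       let i , fi≡u = p u∈S
           j , fj≡v = p v∈S
       in subst₂ (Adjacent G) fi≡u fj≡v (adj (λ i≡j → u≢v (trans (sym fi≡u) (trans (cong f i≡j) fj≡v)))))
  where
  inj : ∀ {k} (f : Fin k → Fin _) → PairwiseAdjacent G f → Injective _≡_ _≡_ f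
  inj f adj {i} {j} eq with i ≟ᶠ j
  ... | yes i≡j = i≡j
  ... | no  i≢j = ⊥-elim (subst T (Graph.irreflexive G (f i)) (subst (Adjacent G (f i)) (sym eq) (adj i≢j)))

-- Pigeonhole: punching out a missed value would inject `Fin (suc n)` into `Fin n`.
injective⇒surjective : ∀ {n} {f : Fin n → Fin n} → Injective _≡_ _≡_ f → ∀ y → ∃[ x ] f x ≡ y
injective⇒surjective {zero}  inj ()
injective⇒surjective {suc n} {f} inj y with any? (λ x → f x ≟ᶠ y)
... | yes p = p
... | no ¬p = contradiction
  (injective⇒≤ {f = λ x → punchOut (y≢f x)} (λ {x} {z} eq → inj (punchOut-injective (y≢f x) (y≢f z) eq))) 1+n≰n
  where
  y≢f : ∀ x → y ≢ f x
  y≢f x eq = ¬p (x , sym eq)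

module _ {n} {H : Graph n} {c} (assign : Fin n → Fin c)
         (clique : ∀ {u v} → assign u ≡ assign v → u ≢ v → Adjacent H u v) where

  private
    fibre : Fin c → Subset n
    fibre i = Vec.tabulate λ v → does (assign v ≟ᶠ i)

    ∈-fibre⁺ : ∀ v → v Subset.∈ fibre (assign v)
    ∈-fibre⁺ v = lookup⇒[]= v _ (trans (lookup∘tabulate _ v) (dec-true (assign v ≟ᶠ assign v) refl))

    ∈-fibre⁻ : ∀ {i v} → v Subset.∈ fibre i → assign v ≡ i
    ∈-fibre⁻ {i} {v} p with assign v ≟ᶠ i | trans (sym (lookup∘tabulate (λ v → does (assign v ≟ᶠ i)) v)) ([]=⇒lookup p)
    ... | yes eq | _ = eq

  fibres : CliquePartition H c
  fibres = record
    { part     = fibre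
    ; disjoint = λ { i≢j (v , p) → let q , r = x∈p∩q⁻ _ _ p in i≢j (trans (sym (∈-fibre⁻ q)) (∈-fibre⁻ r)) }
    ; cover    = λ v → assign v , ∈-fibre⁺ v
    ; complete = λ i p q → clique (trans (∈-fibre⁻ p) (sym (∈-fibre⁻ q)))
    }

-- Discrete intermediate value principle: walk up from the bottom and stop as soon as the next
-- element falls into `B`, at the latest at the top.
crossing : ∀ m {A B : Fin (2 + m) → Set} → (∀ s → A s ⊎ B s) → A zero → B (fromℕ (suc m)) →
           Σ[ t ∈ Fin (suc m) ] (A (inject₁ t) × B (suc t))
crossing zero    A⊎B a b = zero , a , b
crossing (suc m) A⊎B a b with A⊎B (suc zero)
... | inj₂ b′ = zero , a , b′
... | inj₁ a′ = let t , p , q = crossing m (A⊎B ∘ suc) a′ b in suc t , p , q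

-- Overlaps of rungs and gates

Clear : ℕ → ℕ → Set
Clear s u = s ≢ u × s ≢ suc u

module _ (m : ℕ) where
  private
    n = suc m
    module Tₙ = Tracks n

    too-far : ∀ {s t} → s ≤ n → ¬ (t + suc (2 * n) ≤ s + m)
    too-far {s} {t} s≤n p = <⇒≱ (begin-strict
      s + m             ≤⟨ +-mono-≤ s≤n (≤-trans (n≤1+n m) (m≤m+n n 0)) ⟩
      2 * n             <⟨ m≤n+m (suc (2 * n)) t ⟩
      t + suc (2 * n)   ∎) p
      where open ≤-Reasoning

    shift : ∀ {s t} → s + suc (2 * n) ≤ t + suc (2 * n) + m → s ≤ t + m
    shift {s} {t} p = +-cancelʳ-≤ (suc (2 * n)) s (t + m) (≤-trans p (≤-reflexive
      (solve 3 (λ t c m → t :+ c :+ m := t :+ m :+ c) refl t (suc (2 * n)) m)))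

  -- A lower start has offset at most `n` and an upper one at least `2 * n + 1`, so only lower with
  -- lower or upper with upper can meet.
  ladders-overlap : ∀ {i j s t} → s ≤ n → t ≤ n → Overlap m (Tₙ.ladder i s) (Tₙ.ladder j t) → i ≡ j × Near m s t
  ladders-overlap s≤n t≤n (_ , _ , inj₁ refl , inj₁ refl , p) =
    near-place m (ladder-range₀ s≤n) (ladder-range₀ t≤n) p
  ladders-overlap {i} {j} s≤n t≤n (_ , _ , inj₁ refl , inj₂ refl , p) =
    contradiction (proj₂ (proj₂ (near-place m {i} {j} (ladder-range₀ s≤n) (ladder-range t≤n) p))) (too-far s≤n)
  ladders-overlap {i} {j} s≤n t≤n (_ , _ , inj₂ refl , inj₁ refl , p) =
    contradiction (proj₁ (proj₂ (near-place m {i} {j} (ladder-range s≤n) (ladder-range₀ t≤n) p))) (too-far t≤n)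
  ladders-overlap s≤n t≤n (_ , _ , inj₂ refl , inj₂ refl , p) =
    let i≡j , q , r = near-place m (ladder-range s≤n) (ladder-range t≤n) p in i≡j , shift q , shift r

  -- Within one region, offset `u + n + 1` being near `s` forces `s` to be at least `u + 2`, and
  -- being near `s + 2 * n + 1` forces `s` below `u`. The rungs `u` and `u + 1` fall in the gap.
  gate-overlaps-ladder : ∀ {i j h s u v} → s ≤ n → u ≤ n → v ≤ n →
    Overlap m (Tₙ.gate i j (u , v)) (Tₙ.ladder h s) → (i ≡ h × Clear s u) ⊎ (j ≡ h × Clear s v)
  gate-overlaps-ladder {s = s} s≤n u≤n v≤n (_ , _ , p , q , near) =
    [ (λ { refl → inj₁ (meets u≤n q near) }) , (λ { refl → inj₂ (meets v≤n q near) }) ]′ p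
    where
    below : ∀ {u} → u + suc n ≤ s + m → suc (suc u) ≤ s
    below {u} p = +-cancelʳ-≤ m (suc (suc u)) s (≤-trans (≤-reflexive
      (solve 2 (λ u m → con 2 :+ u :+ m := u :+ (con 2 :+ m)) refl u m)) p)
    above : ∀ {u} → s + suc (2 * n) ≤ u + suc n + m → suc s ≤ u
    above {u} p = +-cancelʳ-≤ (2 * n) (suc s) u (≤-trans (≤-reflexive (sym (+-suc s (2 * n)))) (≤-trans p (≤-reflexive
      (solve 2 (λ u m → u :+ (con 2 :+ m) :+ m := u :+ con 2 :* (con 1 :+ m)) refl u m))))
    meets : ∀ {i u h y} → u ≤ n → y ∈ᵗ Tₙ.ladder h s → Near m (Tₙ.place i (u + suc n)) y → i ≡ h × Clear s u
    meets {u = u} u≤n (inj₁ refl) p =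
      let i≡h , q , _ = near-place m (gate-range u≤n) (ladder-range₀ s≤n) p
          2+u≤s = below q
      in i≡h , >⇒≢ (<-trans (n<1+n u) 2+u≤s) , >⇒≢ 2+u≤s
    meets u≤n (inj₂ refl) p =
      let i≡h , _ , q = near-place m (gate-range u≤n) (ladder-range s≤n) p
          s<u = above q
      in i≡h , <⇒≢ s<u , <⇒≢ (m≤n⇒m≤1+n s<u)

  -- From a clique partition to a clique

  module _ (k : ℕ) (E : List (ℕ × ℕ)) (D : List Track) (H : Graph (length D))
           (adjacent⇔ : ∀ {u v} → Adjacent H u v ⇔ (u ≢ v × Overlap m (lookup D u) (lookup D v))) where

    module FromPartition (P : CliquePartition H (2 * k)) (kind⁻¹ : ∀ {d} → Kind n E k d → d ∈ D) where
      open CliquePartition P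

      partOf : ∀ {d} → d ∈ D → Fin (2 * k)
      partOf p = proj₁ (cover (Any.index p))

      same-part : ∀ {d e} (p : d ∈ D) (q : e ∈ D) → partOf p ≡ partOf q → Overlap m d e
      same-part p q eq with Any.index p ≟ᶠ Any.index q
      -- Both memberships name the same vertex, and a 2-interval overlaps itself.
      ... | yes i≡j = subst₂ (Overlap m) (sym (lookup-index p)) (trans (cong (lookup D) i≡j) (sym (lookup-index q)))
                        (_ , _ , inj₁ refl , inj₁ refl , Near-refl _)
      ... | no  i≢j = subst₂ (Overlap m) (sym (lookup-index p)) (sym (lookup-index q))
        (proj₂ (Equivalence.to adjacent⇔
          (complete _ (proj₂ (cover (Any.index p)))
                      (subst (λ c → _ Subset.∈ part c) (sym eq) (proj₂ (cover (Any.index q)))) i≢j)))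

      ladder∈D : (i : Fin k) (s : Fin (suc n)) → Tₙ.ladder (toℕ i) (toℕ s) ∈ D
      ladder∈D i s = kind⁻¹ (ladder (toℕ<n i) (toℕ<n s))

      ladderPart : Fin k → Fin (suc n) → Fin (2 * k)
      ladderPart i s = partOf (ladder∈D i s)

      same-ladder : ∀ {i j s t} → ladderPart i s ≡ ladderPart j t → i ≡ j × Near m (toℕ s) (toℕ t)
      same-ladder {i} {j} {s} {t} eq =
        let p , q = ladders-overlap (≤-pred (toℕ<n s)) (≤-pred (toℕ<n t)) (same-part (ladder∈D i s) (ladder∈D j t) eq)
        in toℕ-injective p , q

      end : Fin 2 → Fin (suc n)
      end zero       = zero
      end (suc zero) = fromℕ n

      ends-far : ∀ b c → Near m (toℕ (end b)) (toℕ (end c)) → b ≡ c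
      ends-far zero       zero       _       = refl
      ends-far (suc zero) (suc zero) _       = refl
      ends-far zero       (suc zero) (_ , p) = contradiction (subst (_≤ m) (toℕ-fromℕ n) p) 1+n≰n
      ends-far (suc zero) zero       (p , _) = contradiction (subst (_≤ m) (toℕ-fromℕ n) p) 1+n≰n

      endPart : Fin 2 × Fin k → Fin (2 * k)
      endPart (b , i) = ladderPart i (end b)

      endPart-injective : Injective _≡_ _≡_ (endPart ∘ remQuot k)
      endPart-injective {c} {d} eq =
        let i≡j , near = same-ladder {proj₂ (remQuot {2} k c)} {proj₂ (remQuot {2} k d)} eq
            b≡b′ = ends-far (proj₁ (remQuot {2} k c)) (proj₁ (remQuot {2} k d)) near
        in trans (sym (combine-remQuot {2} k c)) (trans (cong₂ combine b≡b′ i≡j) (combine-remQuot {2} k d))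

      -- The 2k end rungs are pairwise non-adjacent, so every part contains one of them.
      owner : ∀ c → ∃[ i ] (ladderPart i (end zero) ≡ c ⊎ ladderPart i (end (suc zero)) ≡ c)
      owner c = let d , eq = injective⇒surjective endPart-injective c in decide (remQuot k d) eq
        where
        decide : ∀ x → endPart x ≡ c → ∃[ i ] (ladderPart i (end zero) ≡ c ⊎ ladderPart i (end (suc zero)) ≡ c)
        decide (zero     , i) eq = i , inj₁ eq
        decide (suc zero , i) eq = i , inj₂ eq

      crossings : ∀ i → Σ[ t ∈ Fin n ] (ladderPart i (end zero) ≡ ladderPart i (inject₁ t) ×
                                        ladderPart i (end (suc zero)) ≡ ladderPart i (suc t))
      crossings i = crossing m split refl refl
        where
        split : ∀ s → ladderPart i (end zero) ≡ ladderPart i s ⊎ ladderPart i (end (suc zero)) ≡ ladderPart i s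
        -- The end rung found in the part of rung `s` overlaps that rung, so it belongs to region
        -- `i` itself.
        split s with owner (ladderPart i s)
        ... | j , inj₁ eq = inj₁ (subst (λ j → ladderPart j (end zero) ≡ ladderPart i s)
          (proj₁ (same-ladder {j} {i} {end zero} {s} eq)) eq)
        ... | j , inj₂ eq = inj₂ (subst (λ j → ladderPart j (end (suc zero)) ≡ ladderPart i s)
          (proj₁ (same-ladder {j} {i} {end (suc zero)} {s} eq)) eq)

      label : Fin k → Fin n
      label i = proj₁ (crossings i)

      -- Labels are ranks, and `opposite` turns a rank back into its vertex.
      choice : Fin k → Fin n
      choice i = opposite (label i)

      rank-choice : ∀ i → rank (choice i) ≡ toℕ (label i)
      rank-choice i = cong toℕ (opposite-involutive (label i))

      -- A gate for the labels of i and j meets neither rung next to the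
      -- crossing of i or of j, so it has no part to belong to.
      no-gate : ∀ {i j} → toℕ j < toℕ i → ¬ ((toℕ (label i) , toℕ (label j)) ∈ E)
      no-gate {i} {j} j<i e∈E =
        -- The part of the gate contains an end rung of some region `h`, and with it one of the two
        -- rungs at the crossing of `h`.
        let h , p = owner (partOf gate∈D)
            _ , q , r = crossings h
        in [ (λ eq → blocked h (inject₁ (label h)) (inj₁ (toℕ-inject₁ (label h))) (trans (sym eq) q))
           , (λ eq → blocked h (suc (label h)) (inj₂ refl) (trans (sym eq) r)) ]′ p
        where
        gate∈D : Tₙ.gate (toℕ i) (toℕ j) (toℕ (label i) , toℕ (label j)) ∈ D
        gate∈D = kind⁻¹ (gate (toℕ<n i) j<i e∈E)

        unclear : ∀ {h i s} → toℕ s ≡ toℕ (label h) ⊎ toℕ s ≡ suc (toℕ (label h)) →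
                  ¬ (toℕ i ≡ toℕ h × Clear (toℕ {suc n} s) (toℕ (label i)))
        unclear {h} {i} s∈ (i≡h , s≢ , s≢suc) =
          [ (λ eq → s≢ (trans eq h≡i)) , (λ eq → s≢suc (trans eq (cong suc h≡i))) ]′ s∈
          where
          h≡i : toℕ (label h) ≡ toℕ (label i)
          h≡i = cong (toℕ ∘ label) (sym (toℕ-injective i≡h))

        blocked : ∀ h s → toℕ s ≡ toℕ (label h) ⊎ toℕ s ≡ suc (toℕ (label h)) → ¬ (partOf gate∈D ≡ ladderPart h s)
        blocked h s s∈ eq = [ unclear {h} {i} {s} s∈ , unclear {h} {j} {s} s∈ ]′
          (gate-overlaps-ladder (≤-pred (toℕ<n s)) (<⇒≤ (toℕ<n (label i))) (<⇒≤ (toℕ<n (label j)))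
            (same-part gate∈D (ladder∈D h s) eq))

      pairwiseAdjacent : (G : Graph n) → (∀ {u v} → Graph.adjacent G u v ≡ false → (rank u , rank v) ∈ E) →
                         PairwiseAdjacent G choice
      pairwiseAdjacent G nonEdge∈E {i} {j} i≢j = ≢false⇒T λ eq → separate eq (<-cmp (toℕ i) (toℕ j))
        where
        ≢false⇒T : ∀ {b} → b ≢ false → T b
        ≢false⇒T {false} p = p refl
        ≢false⇒T {true}  p = _

        chosen∈E : ∀ {i j} → Graph.adjacent G (choice i) (choice j) ≡ false → (toℕ (label i) , toℕ (label j)) ∈ E
        chosen∈E {i} {j} eq = subst₂ (λ x y → (x , y) ∈ E) (rank-choice i) (rank-choice j) (nonEdge∈E eq)

        separate : Graph.adjacent G (choice i) (choice j) ≡ false → ¬ Tri (toℕ i < toℕ j) (toℕ i ≡ toℕ j) (toℕ j < toℕ i)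
        separate eq (tri≈ _ i≡j _) = i≢j (toℕ-injective i≡j)
        separate eq (tri> _ _ j<i) = no-gate j<i (chosen∈E eq)
        -- Gates run only from the larger region index to the smaller, so this order needs the
        -- symmetric pair.
        separate eq (tri< i<j _ _) = no-gate i<j (chosen∈E (trans (Graph.symmetric G (choice j) (choice i)) eq))

  -- From a clique to a clique partition

  infix 4 _pierces_

  -- A start `a` here stands for the integers from `a` to `a + m`; two such ranges meet exactly when
  -- their starts are near.
  _pierces_ : ℕ → Track → Set
  p pierces d = ∃[ a ] (a ∈ᵗ d × a ≤ p × p ≤ a + m)

  pierced-overlap : ∀ {p d e} → p pierces d → p pierces e → Overlap m d e
  pierced-overlap (a , a∈d , a≤p , p≤a+m) (b , b∈e , b≤p , p≤b+m) =
    a , b , a∈d , b∈e , ≤-trans a≤p p≤b+m , ≤-trans b≤p p≤a+m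

  stab : ℕ → ℕ → Fin 2 → ℕ
  stab i x zero       = Tₙ.place i (x + n)
  stab i x (suc zero) = Tₙ.place i (x + suc (2 * n))

  module _ (i : ℕ) where
    private
      W : ℕ
      W = suc (4 * n)

      lift : ∀ {x y} → x ≤ y → Tₙ.place i x ≤ Tₙ.place i y
      lift = +-monoʳ-≤ (i * W)

      lift+m : ∀ {x y} → x ≤ y + m → Tₙ.place i x ≤ Tₙ.place i y + m
      lift+m {x} {y} p = ≤-trans (lift p) (≤-reflexive (sym (+-assoc (i * W) y m)))

    -- Rungs up to `x` are pierced in their upper interval by `x + 2 * n + 1`, the rungs above `x`
    -- in their lower interval by `x + n`.
    stab-ladder : ∀ {x s} → x ≤ m → s ≤ n → ∃[ b ] stab i x b pierces Tₙ.ladder i s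
    stab-ladder {x} {s} x≤m s≤n with s ≤? x
    ... | yes s≤x = suc zero , _ , inj₂ refl , lift (+-monoˡ-≤ (suc (2 * n)) s≤x) ,
      lift+m (≤-trans (+-monoˡ-≤ (suc (2 * n)) (≤-trans x≤m (m≤n+m m s))) (≤-reflexive
        (solve 3 (λ s m c → s :+ m :+ c := s :+ c :+ m) refl s m (suc (2 * n)))))
    ... | no  s≰x = zero , _ , inj₁ refl , lift (≤-trans s≤n (m≤n+m n x)) ,
      lift+m (≤-trans (≤-reflexive (+-suc x m)) (+-monoˡ-≤ m (≰⇒> s≰x)))

    -- The gate covers the offsets from `u + n + 1` to `u + 2 * n`. For `u ≡ x` these lie strictly
    -- between the two points; a smaller `u` reaches the lower point, a larger one the upper.
    stab-gate : ∀ {x u} → x ≤ m → u ≤ m → u ≢ x → ∃[ b ]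
      (Tₙ.place i (u + suc n) ≤ stab i x b × stab i x b ≤ Tₙ.place i (u + suc n) + m)
    stab-gate {x} {u} x≤m u≤m u≢x with <-cmp u x
    ... | tri≈ _ u≡x _ = contradiction u≡x u≢x
    ... | tri< u<x _ _ = zero , lift (≤-trans (≤-reflexive (+-suc u n)) (+-monoˡ-≤ n u<x)) ,
      lift+m (≤-trans (+-monoˡ-≤ n x≤m) (≤-trans (≤-reflexive (+-comm m n)) (+-monoˡ-≤ m (≤-trans (n≤1+n n) (m≤n+m (suc n) u)))))
    ... | tri> _ _ x<u = suc zero ,
      lift (≤-trans (+-monoˡ-≤ (suc n) (m≤n⇒m≤1+n u≤m)) (≤-trans (≤-reflexive (+-suc n n))
        (≤-trans (s≤s (+-monoʳ-≤ n (m≤m+n n 0))) (m≤n+m (suc (2 * n)) x)))) ,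
      lift+m (≤-trans (≤-reflexive (+-suc x (2 * n))) (≤-trans (+-monoˡ-≤ (2 * n) x<u) (≤-reflexive
        (solve 2 (λ u m → u :+ con 2 :* (con 1 :+ m) := u :+ (con 2 :+ m) :+ m) refl u m))))

  module ToPartition (k : ℕ) (E : List (ℕ × ℕ)) (G : Graph n)
    (∈E⇒nonEdge : ∀ {e} → e ∈ E → ∃[ u ] ∃[ v ] (Graph.adjacent G u v ≡ false × e ≡ (rank u , rank v)))
    (f : Fin k → Fin n) (adj : PairwiseAdjacent G f) where

    x : Fin k → ℕ
    x i = rank (f i)

    point : Fin (2 * k) → ℕ
    point c = let b , i = remQuot {2} k c in stab (toℕ i) (x i) b

    point-combine : ∀ b i → point (combine b i) ≡ stab (toℕ i) (x i) b
    point-combine b i = cong (λ (b , i) → stab (toℕ i) (x i) b) (remQuot-combine b i)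

    x≤m : ∀ i → x i ≤ m
    x≤m i = ≤-pred (rank<n (f i))

    Pierced : Track → Set
    Pierced d = ∃[ c ] point c pierces d

    at : ∀ {d} b i → stab (toℕ i) (x i) b pierces d → Pierced d
    at b i p = combine b i , subst (_pierces _) (sym (point-combine b i)) p

    pierced : ∀ {d} → Kind n E k d → Pierced d
    pierced (ladder {s = s} i<k s<1+n) with fromℕ< i<k | toℕ-fromℕ< i<k
    ... | i | refl = let b , p = stab-ladder (toℕ i) (x≤m i) (≤-pred s<1+n) in at b i p
    pierced (gate i<k j<i e∈E)
      with fromℕ< i<k | toℕ-fromℕ< i<k | fromℕ< (<-trans j<i i<k) | toℕ-fromℕ< (<-trans j<i i<k) | ∈E⇒nonEdge e∈E
    ... | i | refl | j | refl | u , v , eq , refl with rank u ≟ x i | rank v ≟ x j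
    ...   | no u≢x | _ =
      let b , lo , hi = stab-gate (toℕ i) (x≤m i) (≤-pred (rank<n u)) u≢x in at b i (_ , inj₁ refl , lo , hi)
    ...   | yes _ | no v≢x =
      let b , lo , hi = stab-gate (toℕ j) (x≤m j) (≤-pred (rank<n v)) v≢x in at b j (_ , inj₂ refl , lo , hi)
    -- Here the gate would belong to the two chosen vertices, but these are adjacent.
    ...   | yes u≡x | yes v≡x = ⊥-elim (subst T
      (trans (cong₂ (Graph.adjacent G) (sym (rank-injective u≡x)) (sym (rank-injective v≡x))) eq)
      (adj (λ i≡j → <⇒≢ j<i (cong toℕ (sym i≡j)))))

    -- Every 2-interval is assigned to a point that pierces it. Those with the same point overlap
    -- there pairwise, so the fibres of the assignment are cliques.
    partition : (D : List Track) (H : Graph (length D)) →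
      (∀ {u v} → Adjacent H u v ⇔ (u ≢ v × Overlap m (lookup D u) (lookup D v))) →
      (∀ {d} → d ∈ D → Kind n E k d) → CliquePartition H (2 * k)
    partition D H adjacent⇔ kind = fibres (proj₁ ∘ pierced-by) λ {u} {v} eq u≢v →
      Equivalence.from adjacent⇔ (u≢v , pierced-overlap
        (subst (λ c → point c pierces lookup D u) eq (proj₂ (pierced-by u))) (proj₂ (pierced-by v)))
      where
      pierced-by : ∀ v → Pierced (lookup D v)
      pierced-by v = pierced (kind (∈-lookup v))

-- Correctness and assembly of the reduction

reduce-correct : ∀ {n} (G : Graph n) k →
  HasClique G k ⇔ CliquePartition (Target.graph (pred n) (trackList G k) (apart G k)) (parts n k)
reduce-correct {zero} G zero = mk⇔
  (λ _ → record { part = λ (); disjoint = λ { {()} }; cover = λ (); complete = λ () })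
  (λ _ → [] , refl , λ { {()} })
reduce-correct {zero} G (suc k) = mk⇔
  -- Without vertices there is no clique of positive size. On the other side every ladder still has
  -- its rung 0, which no part can cover as there are none.
  (λ { ([] , () , _) })
  (λ P → contradiction (proj₁ (CliquePartition.cover P zero)) λ ())
reduce-correct {suc m} G k = mk⇔
  (λ clique → let f , adj = Equivalence.to (HasClique⇔PairwiseAdjacent G) clique
              in ToPartition.partition m k E G (Equivalence.to (∈-nonEdges G)) f adj D H adjacent⇔ (kind (suc m) E k))
  (λ P → Equivalence.from (HasClique⇔PairwiseAdjacent G)
    (_ , FromPartition.pairwiseAdjacent m k E D H adjacent⇔ P (kind⁻¹ (suc m) E k) G
           (λ eq → Equivalence.from (∈-nonEdges G) (_ , _ , eq , refl))))
  where
  E : List (ℕ × ℕ)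
  E = nonEdges (rows G)
  D : List Track
  D = trackList G k
  H : Graph (length D)
  H = Target.graph m D (apart G k)
  adjacent⇔ : ∀ {u v} → Adjacent H u v ⇔ (u ≢ v × Overlap m (lookup D u) (lookup D v))
  adjacent⇔ = Target.adjacent⇔Overlap m D (apart G k)

-- Bounding a polynomial by a pure power requires an argument of at least 2.
2≤size-∙ : ∀ s t → 2 ≤ size (s ∙ t)
2≤size-∙ s t = s≤s (≤-trans (size≥1 s) (m≤m+n (size s) (size t)))

theorem11 : W[1]-hard k-VertexCliquePartition-unit2Interval
theorem11 = record
  { reduce          = reduce
  ; equivalent      = λ x → reduce-correct (CliqueInstance.graph x) (CliqueInstance.k x)
  ; h               = 2 *_
  ; h-computable    = program (twice (var zero)) , λ k →
      let τ , t , run , result , t≤ = program-maps (twice (var zero)) (encodeUnary k)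
      in _ , τ , t , run , trans result (value (⇓-twice {t = var zero} {encodeUnary k ∷ []} {k} (den refl))) , t≤
  ; parameter-bound = λ x → parts≤ (CliqueInstance.n x) (CliqueInstance.k x)
  -- The reduction runs in polynomial time, so the factor depending on the parameter is constant.
  ; g               = λ _ → 1
  ; g-computable    = program (nil ∙ nil) , λ k → _ , program-maps (nil ∙ nil) (encodeUnary k)
  ; exponent        = exponentᵗ reductionᵗ
  ; program         = program reductionᵗ
  ; program-correct = λ x →
      let τ , t , run , result , t≤ = program-maps-^ reductionᵗ (ParameterizedProblem.encode k-Clique x)
                                        (2≤size-∙ (encodeGraph (CliqueInstance.graph x)) (encodeUnary (CliqueInstance.k x)))
      in τ , t , run , trans result (value (⇓-reduction x)) , t≤
  }
  where
  parts≤ : ∀ n k → parts n k ≤ 2 * k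
  parts≤ zero    k = z≤n
  parts≤ (suc n) k = ≤-refl
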